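{- Let $q$ be a prime power and let $n \geq 1$ be an integer. (a) Assume that we are in neither of the following two cases: (i) $q$ is prime and $n = 1$; (ii) $q = 2$ and $n = 2$. Then for every automorphism $\Psi$ of $\mathbb{P}^n$ with fractional jump $\psi : \mathbb{A}^n \to \mathbb{A}^n$, $\Psi$ acts transitively on $\mathbb{P}^n$ if and only if $\psi$ acts transitively on $\mathbb{A}^n$. (b) In each of the exceptional cases the equivalence fails: if $q$ is prime and $n = 1$, or if $q = 2$ and $n = 2$, there exists an automorphism $\Psi$ of $\mathbb{P}^n$ whose fractional jump $\psi$ acts transitively on $\mathbb{A}^n$ while $\Psi$ does not act transitively on $\mathbb{P}^n$.
   Context: $\mathbb{F}_q$ is the finite field with $q$ elements. $\mathbb{A}^n = \mathbb{F}_q^n$ denotes the $n$-dimensional affine space, as a set of $\mathbb{F}_q$-points, and $\mathbb{P}^n$ is the $n$-dimensional projective space over $\mathbb{F}_q$, i.e. the set of $\mathbb{F}_q$-points $[X_0 : \ldots : X_n]$. An automorphism of $\mathbb{P}^n$ is an element of $\mathrm{PGL}_{n+1}(\mathbb{F}_q) = \mathrm{GL}_{n+1}(\mathbb{F}_q)/\mathbb{F}_q^* \mathrm{Id}$, acting on $\mathbb{P}^n$ in the usual way. Write $\mathbb{P}^n = U \cup H$ with $U = \{[X_0 : \ldots : X_n] : X_n \neq 0\}$ and $H = \{[X_0 : \ldots : X_n] : X_n = 0\}$, and let $\pi : \mathbb{A}^n \to U$ be the bijection $(x_1, \ldots, x_n) \mapsto [x_1 : \ldots : x_n : 1]$. Let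 $\Psi$ be an automorphism of $\mathbb{P}^n$. For $P \in U$ the fractional jump index of $\Psi$ at $P$ is $\mathfrak{J}_P = \min\{k \in \mathbb{Z}_{\geq 1} : \Psi^k(P) \in U\}$. The fractional jump of $\Psi$ is the map $\psi : \mathbb{A}^n \to \mathbb{A}^n$, $\psi(x) = \pi^{ -1}\big(\Psi^{\mathfrak{J}_{\pi(x)}}(\pi(x))\big)$ (this is a bijection). A bijective map $f : X \to X$ acts transitively on $X$ if for any $x, y \in X$ there exists $k \in \mathbb{Z}$ such that $y = f^k(x)$. -}

module Defs where

open import Algebra.Apartness.Bundles using (HeytingField; HeytingCommutativeRing)
open import Algebra.Bundles using (CommutativeRing)
open import Algebra.Definitions using (Invertible)
import Algebra.Properties.Ring
import Algebra.Properties.Semiring.Sum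
open import Data.Bool.Base using (if_then_else_)
open import Data.Fin.Base as Fin using (Fin; zero; suc; fromℕ; toℕ; punchIn; funToFin; finToFun)
import Data.Fin.Properties as Fin
open import Data.Integer.Base as ℤ using (ℤ; +_; -[1+_])
open import Data.Nat.Base as ℕ using (ℕ; zero; suc; z≤n; s≤s; _≤_; _<_; _∸_)
open import Data.Nat.GeneralisedArithmetic using (fold)
open import Data.Nat.Primality using (Prime)
import Data.Nat.Properties as ℕ
open import Data.Product.Base using (∃; ∃-syntax; _×_; _,_; proj₁; proj₂)
open import Data.Sum.Base using (_⊎_; inj₁; inj₂)
open import Data.Vec.Functional as Vector using (Vector; insertAt; removeAt)
import Data.Vec.Functional.Properties as Vector
import Data.Vec.Functional.Relation.Binary.Equality.Setoid as VectorEquality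
open import Function.Base using (_∘_)
open import Function.Bundles using (Inverse)
import Function.Construct.Composition as Composition
import Function.Construct.Symmetry as Symmetry
open import Level using (Level; _⊔_) renaming (suc to lsuc)
open import Relation.Binary.Bundles using (Setoid)
import Relation.Binary.Construct.On as On
open import Relation.Binary.Definitions using (_Respects_)
open import Relation.Binary.PropositionalEquality as ≡ using (_≡_)
import Relation.Binary.Reasoning.Setoid as SetoidReasoning
open import Relation.Nullary.Decidable using (Dec; yes; no; does; map′; ¬?; decidable-stable)
open import Relation.Nullary.Negation using (¬_; contradiction)
open import Relation.Unary using (Pred; Decidable; _∈_)

IsPrimePower : ℕ → Set
IsPrimePower q = ∃[ p ] ∃[ e ] Prime p × 1 ≤ e × q ≡ p ℕ.^ e

IsLeast : ∀ {p} → Pred ℕ p → ℕ → Set p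
IsLeast P k = k ∈ P × (∀ j → j ∈ P → k ≤ j)

module _ {p} {P : Pred ℕ p} where

  IsLeast-unique : ∀ {j k} → IsLeast P j → IsLeast P k → j ≡ k
  IsLeast-unique (Pj , j≤) (Pk , k≤) = ℕ.≤-antisym (j≤ _ Pk) (k≤ _ Pj)

  search : Decidable P → ∀ n → (∃[ k ] IsLeast P k) ⊎ (∀ j → j < n → ¬ (j ∈ P))
  search P? zero    = inj₂ λ _ ()
  search P? (suc n) with search P? n
  ... | inj₁ found = inj₁ found
  ... | inj₂ none  with P? n
  ...   | yes Pn = inj₁ (n , Pn , λ j Pj → ℕ.≮⇒≥ λ j<n → none j j<n Pj)
  ...   | no ¬Pn = inj₂ below
    where
    below : ∀ j → j < suc n → ¬ (j ∈ P)
    below j j<1+n Pj with ℕ.m≤n⇒m<n∨m≡n (ℕ.s≤s⁻¹ j<1+n)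
    ... | inj₁ j<n    = none j j<n Pj
    ... | inj₂ ≡.refl = ¬Pn Pj

  least : Decidable P → ∃ P → ∃[ k ] IsLeast P k
  least P? (n , Pn) with search P? (suc n)
  ... | inj₁ found = found
  ... | inj₂ none  = contradiction Pn (none n (ℕ.n<1+n n))

module Dynamics {a ℓ} (S : Setoid a ℓ) where

  open Setoid S
  open Inverse using (to; from; to-cong; from-cong; strictlyInverseˡ; strictlyInverseʳ)

  infixr 8 _^_

  _^_ : Inverse S S → ℤ → Carrier → Carrier
  (f ^ (+ k))    x = fold x (to f) k
  (f ^ -[1+ k ]) x = fold x (from f) (suc k)

  Transitive : Inverse S S → Set (a ⊔ ℓ)
  Transitive f = ∀ x y → ∃[ k ] y ≈ (f ^ k) x

  iterate-cong : ∀ (f : Inverse S S) k {x y} → x ≈ y → (f ^ (+ k)) x ≈ (f ^ (+ k)) y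
  iterate-cong f zero    x≈y = x≈y
  iterate-cong f (suc k) x≈y = to-cong f (iterate-cong f k x≈y)

  iterate-+ : ∀ (f : Inverse S S) j k x → (f ^ (+ (j ℕ.+ k))) x ≈ (f ^ (+ j)) ((f ^ (+ k)) x)
  iterate-+ f zero    k x = refl
  iterate-+ f (suc j) k x = to-cong f (iterate-+ f j k x)

  iterate-injective : ∀ (f : Inverse S S) k {x y} → (f ^ (+ k)) x ≈ (f ^ (+ k)) y → x ≈ y
  iterate-injective f zero    eq = eq
  iterate-injective f (suc k) eq = iterate-injective f k
    (trans (sym (strictlyInverseʳ f _)) (trans (from-cong f eq) (strictlyInverseʳ f _)))

  Recurrent : Inverse S S → Set (a ⊔ ℓ)
  Recurrent f = ∀ x → ∃[ k ] 1 ≤ k × (f ^ (+ k)) x ≈ x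

  finite⇒recurrent : ∀ {N} (code : Carrier → Fin N) → (∀ {x y} → code x ≡ code y → x ≈ y) →
                     ∀ f → Recurrent f
  finite⇒recurrent {N} code code-injective f x
    with i , j , i<j , same ← Fin.pigeonhole (ℕ.n<1+n N) (λ i → code ((f ^ (+ toℕ i)) x)) =
      toℕ j ∸ toℕ i , ℕ.m<n⇒0<n∸m i<j , sym (iterate-injective f (toℕ i) (trans (code-injective same) split))
    where
    split : (f ^ (+ toℕ j)) x ≈ (f ^ (+ toℕ i)) ((f ^ (+ (toℕ j ∸ toℕ i))) x)
    split = trans (reflexive (≡.cong (λ k → (f ^ (+ k)) x) (≡.sym (ℕ.m+[n∸m]≡n (ℕ.<⇒≤ i<j)))))
                  (iterate-+ f (toℕ i) (toℕ j ∸ toℕ i) x)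

  unwind : ∀ (f : Inverse S S) k x → (Symmetry.inverse f ^ (+ k)) ((f ^ (+ k)) x) ≈ x
  unwind f zero    x = refl
  unwind f (suc k) x = trans (reflexive (shift k _))
    (trans (iterate-cong (Symmetry.inverse f) k (strictlyInverseʳ f _)) (unwind f k x))
    where
    shift : ∀ k y → from f (fold y (from f) k) ≡ fold (from f y) (from f) k
    shift zero    y = ≡.refl
    shift (suc k) y = ≡.cong (from f) (shift k y)

  unwind-part : ∀ (f : Inverse S S) {j k} → j ≤ k → ∀ x →
                (Symmetry.inverse f ^ (+ j)) ((f ^ (+ k)) x) ≈ (f ^ (+ (k ∸ j))) x
  unwind-part f {j} {k} j≤k x = trans
    (iterate-cong (Symmetry.inverse f) j
      (trans (reflexive (≡.cong (λ i → (f ^ (+ i)) x) (≡.sym (ℕ.m+[n∸m]≡n j≤k))))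
             (iterate-+ f j (k ∸ j) x)))
    (unwind f j _)

  module FirstReturn {p} (U : Pred Carrier p) (U-resp : U Respects _≈_) (U? : Decidable U) where

    Subset : Setoid (a ⊔ p) ℓ
    Subset = On.setoid S (proj₁ {B = U})

    IsReturnTime : Inverse S S → Carrier → Pred ℕ p
    IsReturnTime f x k = 1 ≤ k × (f ^ (+ k)) x ∈ U

    isReturnTime? : ∀ f x → Decidable (IsReturnTime f x)
    isReturnTime? f x zero    = no λ ()
    isReturnTime? f x (suc k) = map′ (λ r → s≤s z≤n , r) proj₂ (U? _)

    firstReturnTime : ∀ f → Recurrent f → ∀ x → x ∈ U → ∃[ k ] IsLeast (IsReturnTime f x) k
    firstReturnTime f recurrent x x∈U with k , 1≤k , fᵏx≈x ← recurrent x =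
      least (isReturnTime? f x) (k , 1≤k , U-resp (sym fᵏx≈x) x∈U)

    step : ∀ f → Recurrent f → ∃ U → ∃ U
    step f recurrent (x , x∈U) =
      let k , (_ , fᵏx∈U) , _ = firstReturnTime f recurrent x x∈U in (f ^ (+ k)) x , fᵏx∈U

    time-unique : ∀ f (recurrent : Recurrent f) x (x∈U : x ∈ U) {k} → IsLeast (IsReturnTime f x) k →
                  proj₁ (firstReturnTime f recurrent x x∈U) ≡ k
    time-unique f recurrent x x∈U =
      IsLeast-unique (proj₂ (firstReturnTime f recurrent x x∈U))

    step-cong : ∀ f (recurrent : Recurrent f) {x y : ∃ U} → proj₁ x ≈ proj₁ y →
                proj₁ (step f recurrent x) ≈ proj₁ (step f recurrent y)
    step-cong f recurrent {x , x∈U} {y , y∈U} x≈y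
      with k , (1≤k , fᵏy∈U) , k-least ← firstReturnTime f recurrent y y∈U =
        trans (reflexive (≡.cong (λ i → (f ^ (+ i)) x) (time-unique f recurrent x x∈U isLeast)))
              (iterate-cong f k x≈y)
      where
      isLeast : IsLeast (IsReturnTime f x) k
      isLeast = (1≤k , U-resp (iterate-cong f k (sym x≈y)) fᵏy∈U) ,
                λ j (1≤j , fʲx∈U) → k-least j (1≤j , U-resp (iterate-cong f j x≈y) fʲx∈U)

    step-back : ∀ f (rf : Recurrent f) (rg : Recurrent (Symmetry.inverse f)) (x : ∃ U) →
                proj₁ (step (Symmetry.inverse f) rg (step f rf x)) ≈ proj₁ x
    step-back f rf rg (x , x∈U)
      with k , (1≤k , fᵏx∈U) , k-least ← firstReturnTime f rf x x∈U =
        trans (reflexive (≡.cong (λ i → (Symmetry.inverse f ^ (+ i)) ((f ^ (+ k)) x))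
                                 (time-unique (Symmetry.inverse f) rg _ fᵏx∈U (returns , minimal))))
              (unwind f k x)
      where
      returns : IsReturnTime (Symmetry.inverse f) ((f ^ (+ k)) x) k
      returns = 1≤k , U-resp (sym (unwind f k x)) x∈U
      minimal : ∀ j → IsReturnTime (Symmetry.inverse f) ((f ^ (+ k)) x) j → k ≤ j
      minimal j (1≤j , back∈U) = ℕ.≮⇒≥ λ j<k →
        ℕ.<⇒≱ (ℕ.∸-monoʳ-< 1≤j (ℕ.<⇒≤ j<k))
              (k-least (k ∸ j) (ℕ.m<n⇒0<n∸m j<k , U-resp (unwind-part f (ℕ.<⇒≤ j<k) x) back∈U))

    firstReturn : ∀ f → Recurrent f → Recurrent (Symmetry.inverse f) → Inverse Subset Subset
    firstReturn f rf rg = record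
      { to        = step f rf
      ; from      = step (Symmetry.inverse f) rg
      ; to-cong   = λ {x} {y} → step-cong f rf {x} {y}
      ; from-cong = λ {x} {y} → step-cong (Symmetry.inverse f) rg {x} {y}
      ; inverse   = (λ {x} {y} y≈ → trans (step-cong f rf {y} {step (Symmetry.inverse f) rg x} y≈)
                                          (step-back (Symmetry.inverse f) rg rf x))
                  , (λ {x} {y} y≈ → trans (step-cong (Symmetry.inverse f) rg {y} {step f rf x} y≈)
                                          (step-back f rf rg x))
      }

record FiniteField (q : ℕ) (c ℓ₁ ℓ₂ : Level) : Set (lsuc (c ⊔ ℓ₁ ⊔ ℓ₂)) where
  field
    heytingField : HeytingField c ℓ₁ ℓ₂
  open HeytingField heytingField public
  open HeytingCommutativeRing heytingCommutativeRing public using (commutativeRing)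
  field
    enumeration : Inverse setoid (≡.setoid (Fin q))

open Dynamics public using (Transitive)

module Geometry {q : ℕ} {c ℓ₁ ℓ₂ : Level} (F : FiniteField q c ℓ₁ ℓ₂) where

  open FiniteField F hiding (zero)

  open Algebra.Properties.Semiring.Sum (CommutativeRing.semiring commutativeRing)
  open VectorEquality setoid using (_≋_; ≋-refl; ≋-sym; ≋-trans; ≋-setoid)
  open SetoidReasoning setoid

  open Setoid setoid using (_≉_)

  module E = Inverse enumeration

  E-injective : ∀ {x y} → E.to x ≡ E.to y → x ≈ y
  E-injective {x} {y} eq = trans (sym (E.strictlyInverseʳ x)) (trans (E.from-cong eq) (E.strictlyInverseʳ y))

  infix 4 _≈?_
  _≈?_ : ∀ x y → Dec (x ≈ y)
  x ≈? y = map′ E-injective E.to-cong (E.to x Fin.≟ E.to y)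

  x-0≈x : ∀ x → x - 0# ≈ x
  x-0≈x x = trans (+-congˡ (Algebra.Properties.Ring.-0#≈0# (CommutativeRing.ring commutativeRing))) (+-identityʳ x)

  rightInverse? : ∀ x → Dec (∃[ y ] x * y ≈ 1#)
  rightInverse? x = map′ (λ (i , eq) → E.from i , eq)
    (λ (y , eq) → E.to y , trans (*-congˡ (E.strictlyInverseʳ y)) eq)
    (Fin.any? λ i → x * E.from i ≈? 1#)

  -- In a Heyting field an element apart from 0 is invertible; finiteness upgrades apartness to _≉_.
  reciprocal : ∀ x → x ≉ 0# → ∃[ y ] x * y ≈ 1#
  reciprocal x x≉0 = decidable-stable (rightInverse? x) λ none →
    x≉0 (proj₁ (tight x 0#) λ x#0 →
      let y , _ , eq = #⇒invertible x#0 in none (y , trans (*-congʳ (sym (x-0≈x x))) eq))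

  nontrivial : 1# ≉ 0#
  nontrivial 1≈0 = proj₂ (tight 0# 0#) refl
    (invertible⇒# (0# , trans (zeroˡ _) (sym 1≈0) , trans (zeroʳ _) (sym 1≈0)))

  factor≉0 : ∀ {x y} → x * y ≈ 1# → y ≉ 0#
  factor≉0 xy≈1 y≈0 = nontrivial (trans (sym xy≈1) (trans (*-congˡ y≈0) (zeroʳ _)))

  product≉0 : ∀ {x y} → x ≉ 0# → y ≉ 0# → x * y ≉ 0#
  product≉0 {x} {y} x≉0 y≉0 xy≈0 with x⁻¹ , xx⁻¹≈1 ← reciprocal x x≉0 = y≉0 (begin
    y              ≈⟨ *-identityˡ y ⟨
    1# * y         ≈⟨ *-congʳ xx⁻¹≈1 ⟨
    x * x⁻¹ * y    ≈⟨ *-congʳ (*-comm x x⁻¹) ⟩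
    x⁻¹ * x * y    ≈⟨ *-assoc x⁻¹ x y ⟩
    x⁻¹ * (x * y)  ≈⟨ *-congˡ xy≈0 ⟩
    x⁻¹ * 0#       ≈⟨ zeroʳ x⁻¹ ⟩
    0#             ∎)

  undo : ∀ {x y z w} → x * y ≈ 1# → z ≈ x * w → w ≈ y * z
  undo {x} {y} {z} {w} xy≈1 z≈xw = begin
    w            ≈⟨ *-identityˡ w ⟨
    1# * w       ≈⟨ *-congʳ (trans (*-comm y x) xy≈1) ⟨
    y * x * w    ≈⟨ *-assoc y x w ⟩
    y * (x * w)  ≈⟨ *-congˡ z≈xw ⟨
    y * z        ∎

  infix 4 _∼_
  _∼_ : ∀ {I : Set} → (I → Carrier) → (I → Carrier) → Set (c ⊔ ℓ₁)
  v ∼ w = ∃[ s ] s ≉ 0# × (∀ i → v i ≈ s * w i)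

  module _ {I : Set} where

    ≈⇒∼ : {v w : I → Carrier} → (∀ i → v i ≈ w i) → v ∼ w
    ≈⇒∼ v≈w = 1# , nontrivial , λ i → trans (v≈w i) (sym (*-identityˡ _))

    ∼-sym : {v w : I → Carrier} → v ∼ w → w ∼ v
    ∼-sym (s , s≉0 , v≈sw) with s⁻¹ , ss⁻¹≈1 ← reciprocal s s≉0 =
      s⁻¹ , factor≉0 ss⁻¹≈1 , λ i → undo ss⁻¹≈1 (v≈sw i)

    ∼-trans : {u v w : I → Carrier} → u ∼ v → v ∼ w → u ∼ w
    ∼-trans (s , s≉0 , u≈sv) (t , t≉0 , v≈tw) =
      s * t , product≉0 s≉0 t≉0 , λ i → trans (u≈sv i) (trans (*-congˡ (v≈tw i)) (sym (*-assoc s t _)))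

  proportionality : Set → Setoid c (c ⊔ ℓ₁)
  proportionality I = record
    { Carrier       = I → Carrier
    ; _≈_           = _∼_
    ; isEquivalence = record { refl = ≈⇒∼ (λ _ → refl) ; sym = ∼-sym ; trans = ∼-trans }
    }

  𝔸 : ℕ → Setoid c ℓ₁
  𝔸 = ≋-setoid

  NonzeroVector : ℕ → Set (c ⊔ ℓ₁)
  NonzeroVector m = ∃[ v ] ¬ (v ≋ Vector.replicate m 0#)

  ℙ : ℕ → Setoid (c ⊔ ℓ₁) (c ⊔ ℓ₁)
  ℙ n = On.setoid (proportionality (Fin (suc n))) λ ((v , _) : NonzeroVector (suc n)) → v

  Matrix : ℕ → Set c
  Matrix m = Fin m → Fin m → Carrier

  infix 4 _≈ᴹ_
  _≈ᴹ_ : ∀ {m} → Matrix m → Matrix m → Set ℓ₁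
  A ≈ᴹ B = ∀ i j → A i j ≈ B i j

  infixl 7 _*ᴹ_
  _*ᴹ_ : ∀ {m} → Matrix m → Matrix m → Matrix m
  _*ᴹ_ {m} A B i k = ∑[ j < m ] (A i j * B j k)

  1ᴹ : ∀ {m} → Matrix m
  1ᴹ i j = if does (i Fin.≟ j) then 1# else 0#

  infixl 7 _*ⱽ_
  _*ⱽ_ : ∀ {m} → Matrix m → Vector Carrier m → Vector Carrier m
  _*ⱽ_ {m} A v i = ∑[ j < m ] (A i j * v j)

  GL : ℕ → Set (c ⊔ ℓ₁)
  GL m = ∃[ A ] Invertible (_≈ᴹ_ {m}) 1ᴹ _*ᴹ_ A

  PGL : ℕ → Setoid (c ⊔ ℓ₁) (c ⊔ ℓ₁)
  PGL m = record
    { Carrier       = GL m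
    ; _≈_           = λ (A , _) (B , _) → entries A ∼ entries B
    ; isEquivalence = On.isEquivalence (λ (A , _) → entries A) (Setoid.isEquivalence (proportionality (Fin m × Fin m)))
    }
    where
    entries : Matrix m → Fin m × Fin m → Carrier
    entries A (i , j) = A i j

  zero-sum : ∀ {m} {v : Vector Carrier m} → (∀ i → v i ≈ 0#) → sum v ≈ 0#
  zero-sum {m} v≈0 = trans (sum-cong-≋ v≈0) (sum-replicate-zero m)

  1ᴹ-*ⱽ : ∀ {m} (v : Vector Carrier m) → 1ᴹ *ⱽ v ≋ v
  1ᴹ-*ⱽ v zero = trans (+-cong (*-identityˡ _) (zero-sum (λ j → zeroˡ (v (suc j))))) (+-identityʳ _)
  1ᴹ-*ⱽ v (suc i) = trans (+-cong (zeroˡ _) (1ᴹ-*ⱽ (Vector.tail v) i)) (+-identityˡ _)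

  *ⱽ-cong : ∀ {m} {A B : Matrix m} {v w} → A ≈ᴹ B → v ≋ w → A *ⱽ v ≋ B *ⱽ w
  *ⱽ-cong A≈B v≈w i = sum-cong-≋ (λ j → *-cong (A≈B i j) (v≈w j))

  *ᴹ-*ⱽ : ∀ {m} (A B : Matrix m) v → (A *ᴹ B) *ⱽ v ≋ A *ⱽ (B *ⱽ v)
  *ᴹ-*ⱽ {m} A B v i = begin
    ∑[ k < m ] (∑[ j < m ] (A i j * B j k) * v k)
      ≈⟨ sum-cong-≋ (λ k → *-distribʳ-sum (v k) (λ j → A i j * B j k)) ⟩
    ∑[ k < m ] ∑[ j < m ] (A i j * B j k * v k)
      ≈⟨ ∑-comm (λ k j → A i j * B j k * v k) ⟩
    ∑[ j < m ] ∑[ k < m ] (A i j * B j k * v k)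
      ≈⟨ sum-cong-≋ (λ j → sum-cong-≋ (λ k → *-assoc (A i j) (B j k) (v k))) ⟩
    ∑[ j < m ] ∑[ k < m ] (A i j * (B j k * v k))
      ≈⟨ sum-cong-≋ (λ j → *-distribˡ-sum (A i j) (λ k → B j k * v k)) ⟨
    ∑[ j < m ] (A i j * ∑[ k < m ] (B j k * v k)) ∎

  *ⱽ-scale : ∀ {m} (A : Matrix m) s {v w : Vector Carrier m} →
             (∀ i → v i ≈ s * w i) → ∀ i → (A *ⱽ v) i ≈ s * (A *ⱽ w) i
  *ⱽ-scale {m} A s {v} {w} v≈sw i = trans
    (sum-cong-≋ λ j → begin
      A i j * v j        ≈⟨ *-congˡ (v≈sw j) ⟩
      A i j * (s * w j)  ≈⟨ *-assoc _ _ _ ⟨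
      A i j * s * w j    ≈⟨ *-congʳ (*-comm _ _) ⟩
      s * A i j * w j    ≈⟨ *-assoc _ _ _ ⟩
      s * (A i j * w j)  ∎)
    (sym (*-distribˡ-sum s (λ j → A i j * w j)))

  cancel : ∀ {m} {A B : Matrix m} → B *ᴹ A ≈ᴹ 1ᴹ → ∀ v → B *ⱽ (A *ⱽ v) ≋ v
  cancel {m} {A} {B} BA≈1 v = ≋-trans (≋-sym (*ᴹ-*ⱽ B A v)) (≋-trans (*ⱽ-cong {A = B *ᴹ A} {B = 1ᴹ} {v = v} BA≈1 ≋-refl) (1ᴹ-*ⱽ v))

  apply : ∀ {m} (A B : Matrix m) → B *ᴹ A ≈ᴹ 1ᴹ → NonzeroVector m → NonzeroVector m
  apply A B BA≈1 (v , v≉0) = A *ⱽ v , λ Av≈0 →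
    v≉0 (≋-trans (≋-sym (cancel {A = A} {B = B} BA≈1 v)) (λ i → zero-sum (λ j → trans (*-congˡ (Av≈0 j)) (zeroʳ _))))

  apply-cong : ∀ {m} (A : Matrix m) {v w : Vector Carrier m} → v ∼ w → A *ⱽ v ∼ A *ⱽ w
  apply-cong A (s , s≉0 , v≈sw) = s , s≉0 , *ⱽ-scale A s v≈sw

  action : ∀ {n} → GL (suc n) → Inverse (ℙ n) (ℙ n)
  action (A , A⁻¹ , A⁻¹A≈1 , AA⁻¹≈1) = record
    { to        = apply A A⁻¹ A⁻¹A≈1
    ; from      = apply A⁻¹ A AA⁻¹≈1
    ; to-cong   = apply-cong A
    ; from-cong = apply-cong A⁻¹
    ; inverse   = (λ y∼ → ∼-trans (apply-cong A y∼) (≈⇒∼ (cancel {A = A⁻¹} {B = A} AA⁻¹≈1 _)))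
                , (λ y∼ → ∼-trans (apply-cong A⁻¹ y∼) (≈⇒∼ (cancel {A = A} {B = A⁻¹} A⁻¹A≈1 _)))
    }

  -- There are no quotient types: an element of PGL is an invertible matrix, and
  -- action-cong shows that its action depends only on its class modulo scalars.
  Automorphism : ℕ → Set (c ⊔ ℓ₁)
  Automorphism n = Setoid.Carrier (PGL (suc n))

  action-cong : ∀ {n} {Φ Ψ : Automorphism n} → Setoid._≈_ (PGL (suc n)) Φ Ψ →
                ∀ P → Setoid._≈_ (ℙ n) (Inverse.to (action Φ) P) (Inverse.to (action Ψ) P)
  action-cong {n} {A , _} {B , _} (s , s≉0 , A≈sB) (v , _) = s , s≉0 , λ i → trans
    (sum-cong-≋ {suc n} (λ j → trans (*-congʳ (A≈sB (i , j))) (*-assoc s (B i j) (v j))))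
    (sym (*-distribˡ-sum s (λ j → B i j * v j)))

  module _ {n : ℕ} where

    open Setoid (ℙ n) using () renaming (Carrier to Point; _≈_ to _≈ᴾ_)

    U : Pred Point ℓ₁
    U (X , _) = X (fromℕ n) ≉ 0#

    U-resp : U Respects _≈ᴾ_
    U-resp (s , s≉0 , X≈sY) X∈U Yₙ≈0 = X∈U (trans (X≈sY (fromℕ n)) (trans (*-congˡ Yₙ≈0) (zeroʳ s)))

    U? : Decidable U
    U? (X , _) = ¬? (X (fromℕ n) ≈? 0#)

    open Dynamics (ℙ n) using (_^_; Recurrent; finite⇒recurrent)
    open Dynamics.FirstReturn (ℙ n) U (λ {P} {Q} → U-resp {P} {Q}) U? public
      using (IsReturnTime; firstReturnTime; firstReturn) renaming (Subset to 𝕌)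

    recurrent : ∀ f → Recurrent f
    recurrent = finite⇒recurrent (λ (X , _) → funToFin (E.to ∘ X)) λ {X} {Y} same →
      ≈⇒∼ {v = proj₁ X} λ i → E-injective (≡.trans (≡.sym (Fin.finToFun-funToFin (E.to ∘ proj₁ X) i))
        (≡.trans (≡.cong (λ k → finToFun k i) same) (Fin.finToFun-funToFin (E.to ∘ proj₁ Y) i)))

    jumpIndex : ∀ (Ψ : Automorphism n) (P : Point) → P ∈ U → ∃[ k ] IsLeast (IsReturnTime (action Ψ) P) k
    jumpIndex Ψ = firstReturnTime (action Ψ) (recurrent (action Ψ))

    -- x ↦ (x₁, …, xₙ, 1): the last homogeneous coordinate has index fromℕ n.
    affine : Vector Carrier n → Vector Carrier (suc n)
    affine x = insertAt x (fromℕ n) 1#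

    affine-last : ∀ x → affine x (fromℕ n) ≈ 1#
    affine-last x = reflexive (Vector.insertAt-lookup x (fromℕ n) 1#)

    affine-punchIn : ∀ x i → affine x (punchIn (fromℕ n) i) ≈ x i
    affine-punchIn x i = reflexive (Vector.insertAt-punchIn x (fromℕ n) 1# i)

    byCoordinate : ∀ {p} {Q : Fin (suc n) → Set p} → Q (fromℕ n) → (∀ i → Q (punchIn (fromℕ n) i)) → ∀ i → Q i
    byCoordinate {Q = Q} Qₙ Qᵢ i with fromℕ n Fin.≟ i
    ... | yes ≡.refl = Qₙ
    ... | no  n≢i    = ≡.subst Q (Fin.punchIn-punchOut n≢i) (Qᵢ _)

    point : Vector Carrier n → ∃ U
    point x = (affine x , λ x≈0 → nontrivial (trans (sym (affine-last x)) (x≈0 (fromℕ n))))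
            , λ 1≈0 → nontrivial (trans (sym (affine-last x)) 1≈0)

    dehomogenise : ∃ U → Vector Carrier n
    dehomogenise ((X , _) , Xₙ≉0) i = removeAt X (fromℕ n) i * proj₁ (reciprocal (X (fromℕ n)) Xₙ≉0)

    module 𝕌 = Setoid 𝕌

    point-cong : ∀ {x y} → x ≋ y → point x 𝕌.≈ point y
    point-cong {x} {y} x≈y = ≈⇒∼ (byCoordinate
      (trans (affine-last x) (sym (affine-last y)))
      (λ i → trans (affine-punchIn x i) (trans (x≈y i) (sym (affine-punchIn y i)))))

    dehomogenise-point : ∀ x → dehomogenise (point x) ≋ x
    dehomogenise-point x i with r , 1r≈1 ← reciprocal (affine x (fromℕ n)) (proj₂ (point x)) = begin
      affine x (punchIn (fromℕ n) i) * r  ≈⟨ *-cong (affine-punchIn x i) (trans (sym (*-identityˡ r)) (trans (*-congʳ (sym (affine-last x))) 1r≈1)) ⟩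
      x i * 1#                            ≈⟨ *-identityʳ (x i) ⟩
      x i                                 ∎

    point-dehomogenise : ∀ P → point (dehomogenise P) 𝕌.≈ P
    point-dehomogenise P@((X , _) , Xₙ≉0) = r , r≉0 , byCoordinate
        (trans (affine-last _) (trans (sym Xₙr≈1) (*-comm _ r)))
        (λ i → trans (affine-punchIn _ i) (*-comm _ r))
      where
      r = proj₁ (reciprocal (X (fromℕ n)) Xₙ≉0)
      Xₙr≈1 : X (fromℕ n) * r ≈ 1#
      Xₙr≈1 = proj₂ (reciprocal (X (fromℕ n)) Xₙ≉0)
      r≉0 : r ≉ 0#
      r≉0 = factor≉0 Xₙr≈1

    dehomogenise-cong : ∀ {P Q} → P 𝕌.≈ Q → dehomogenise P ≋ dehomogenise Q
    dehomogenise-cong {(X , _) , Xₙ≉0} {(Y , _) , Yₙ≉0} (s , s≉0 , X≈sY) i = begin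
      X j * r              ≈⟨ *-congˡ (*-identityʳ r) ⟨
      X j * (r * 1#)       ≈⟨ *-congˡ (*-congˡ Yₙt≈1) ⟨
      X j * (r * (Yₙ * t)) ≈⟨ *-congʳ (X≈sY j) ⟩
      s * Y j * (r * (Yₙ * t)) ≈⟨ *-congʳ (*-comm s (Y j)) ⟩
      Y j * s * (r * (Yₙ * t)) ≈⟨ *-assoc (Y j) s _ ⟩
      Y j * (s * (r * (Yₙ * t))) ≈⟨ *-congˡ (begin
        s * (r * (Yₙ * t))  ≈⟨ *-congˡ (*-assoc r Yₙ t) ⟨
        s * (r * Yₙ * t)    ≈⟨ *-congˡ (*-congʳ (*-comm r Yₙ)) ⟩
        s * (Yₙ * r * t)    ≈⟨ *-congˡ (*-assoc Yₙ r t) ⟩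
        s * (Yₙ * (r * t))  ≈⟨ *-assoc s Yₙ _ ⟨
        s * Yₙ * (r * t)    ≈⟨ *-congʳ (X≈sY (fromℕ n)) ⟨
        Xₙ * (r * t)        ≈⟨ *-assoc Xₙ r t ⟨
        Xₙ * r * t          ≈⟨ *-congʳ Xₙr≈1 ⟩
        1# * t              ≈⟨ *-identityˡ t ⟩
        t                   ∎) ⟩
      Y j * t              ∎
      where
      j = punchIn (fromℕ n) i
      Xₙ = X (fromℕ n)
      Yₙ = Y (fromℕ n)
      r = proj₁ (reciprocal Xₙ Xₙ≉0)
      Xₙr≈1 : Xₙ * r ≈ 1#
      Xₙr≈1 = proj₂ (reciprocal Xₙ Xₙ≉0)
      t = proj₁ (reciprocal Yₙ Yₙ≉0)
      Yₙt≈1 : Yₙ * t ≈ 1#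
      Yₙt≈1 = proj₂ (reciprocal Yₙ Yₙ≉0)

    π : Inverse (𝔸 n) 𝕌
    π = record
      { to        = point
      ; from      = dehomogenise
      ; to-cong   = λ {x} {y} → point-cong {x} {y}
      ; from-cong = λ {P} {Q} → dehomogenise-cong {P} {Q}
      ; inverse   = (λ {P} {x} x≈ → ∼-trans (point-cong {x} {dehomogenise P} x≈) (point-dehomogenise P))
                  , (λ {x} {P} P≈ → ≋-trans (dehomogenise-cong {P} {point x} P≈) (dehomogenise-point x))
      }

    -- π⁻¹ ∘ (first return map of Ψ to U) ∘ π; the bijection's inverse is the jump of Ψ⁻¹.
    fractionalJump : Automorphism n → Inverse (𝔸 n) (𝔸 n)
    fractionalJump Ψ = Composition.inverse π (Composition.inverse returnMap (Symmetry.inverse π))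
      where
      returnMap : Inverse 𝕌 𝕌
      returnMap = firstReturn (action Ψ) (recurrent (action Ψ)) (recurrent (Symmetry.inverse (action Ψ)))

    -- ψ(x) = π⁻¹(Ψ^J(π(x))), where J is the jump index at π(x).
    fractionalJump-formula : ∀ Ψ x → let open Inverse π in
      let J , (_ , ΨᴶP∈U) , _ = jumpIndex Ψ (proj₁ (to x)) (proj₂ (to x)) in
      Inverse.to (fractionalJump Ψ) x ≡ from ((action Ψ ^ (+ J)) (proj₁ (to x)) , ΨᴶP∈U)
    fractionalJump-formula Ψ x = ≡.refl

{-# OPTIONS --safe #-}
module Submission where

-- Write A for a matrix of Ψ, H for the hyperplane at infinity and v for the last
-- standard basis vector.  Since ψ is the first return map of Ψ to U, ψ is transitive
-- exactly when any two points of U lie on one orbit of Ψ (jump-transitive⇔).  So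
-- transitivity passes from Ψ to ψ, and it passes back unless some orbit of Ψ stays
-- inside H, that is, unless the space W of vectors whose A-orbit stays in H is nonzero.
--
-- Suppose that U lies on one orbit and W is nonzero.  The vectors outside W are then the
-- vectors s Aᵏ v with s a nonzero scalar.  They span, so that x ↦ x v identifies the
-- commutative algebra R = F[A] with the whole space.  Under this identification W is an
-- ideal of R, and every element outside it is a unit of the form s aᵏ, where a = A.  Thus R
-- is a finite local ring whose group of units modulo scalars is cyclic, and 1 + W embeds in
-- that group.  Hence at most k elements w of W satisfy (1 + w)ᵏ = 1 (torsion-bound).
--
-- This rigidity determines R.  Elements of W are nilpotent (nilpotent), so W contains some
-- z ≠ 0 with z² = 0.  In characteristic p every multiple λz satisfies (1 + λz)ᵖ = 1, hence
-- q ≤ p, so that q = p, and the solutions of (1 + w)ᵖ = 1 in W are exactly the multiples of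
-- z (torsion⇒multiple).  As (az)² = 0, this applies to az: az = αz for a scalar α, and
-- g = a - α kills z.  The ring R is generated by g over F, so W = gR (W-principal), and W
-- is all of H (H⊆W).  Let r be the least exponent with gʳ = 0.
--   * If r = 2, every w in W = H has w² = 0, so qⁿ = |H| ≤ p and n = 1.
--   * If r = 3 and p is odd, then (1 + g)ᵖ = 1, so g is a multiple of z and g² = 0.
--   * If r = 3 and p = 2, every w in H satisfies (1 + w)⁴ = 1, so 2ⁿ ≤ 4.
--   * If r ≥ 4, the square of gʳ⁻² vanishes, so gʳ⁻² is a multiple of z and gʳ⁻¹ = 0.
-- The second and the fourth case are absurd, and the others are the exceptional cases
-- (H-bound).
--
-- In the exceptional cases a unipotent Jordan block moves the origin of the affine space
-- through all of U, but it fixes the point [1 : 0 : ... : 0] of H.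

open import Defs
open import Data.Nat.Base using (ℕ; _≤_)
open import Data.Nat.Primality using (Prime)
open import Data.Product.Base using (_×_; Σ-syntax)
open import Data.Sum.Base using (_⊎_)
open import Function.Bundles using (_⇔_)
open import Level using (Level)
open import Relation.Binary.PropositionalEquality using (_≡_)
open import Relation.Nullary.Negation using (¬_)

open import Algebra.Bundles using (CommutativeRing)
import Algebra.Properties.AbelianGroup
import Algebra.Properties.CommutativeSemigroup
import Algebra.Properties.CommutativeSemiring.Exp
import Algebra.Properties.Group
import Algebra.Properties.Ring
import Algebra.Properties.Semiring.Mult
import Algebra.Properties.Semiring.Sum
import Algebra.Solver.Ring.NaturalCoefficients.Default
open import Algebra.Structures using (IsCommutativeRing)
open import Data.Fin.Base as Fin using (Fin; zero; suc; toℕ; fromℕ<)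
open import Data.Fin.Patterns using (0F; 1F; 2F)
open import Data.Fin.Permutation using (permutation)
import Data.Fin.Properties as Fin
open import Data.Integer.Base using (+_; -[1+_])
open import Data.Nat.Base as ℕ using (zero; suc; _<_; _∸_; z≤n; s≤s; NonZero; >-nonZero)
open import Data.Nat.Coprimality using (prime⇒coprime; coprime-Bézout)
open import Data.Nat.Divisibility using (_∣_; m%n≡0⇒n∣m)
open import Data.Nat.DivMod using (_%_; _/_; m≡m%n+[m/n]*n; m%n<n)
open import Data.Nat.GCD using (module Bézout)
open import Data.Nat.Induction using (<-rec)
open import Data.Nat.Primality using (prime[2]; prime⇒irreducible; prime⇒nonTrivial; prime⇒nonZero)
import Data.Nat.Properties as ℕ
import Data.Nat.Solver
open import Data.Product.Base as Product using (∃; ∃-syntax; _,_; proj₁; proj₂)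
open import Data.Sum.Base using (inj₁; inj₂; [_,_]′)
open import Data.Vec.Functional using (Vector; insertAt)
import Data.Vec.Functional.Properties as Vector
import Data.Vec.Functional.Relation.Binary.Equality.Setoid as VectorEquality
open import Function.Base using (_∘_; id)
open import Function.Bundles using (Equivalence; Inverse; mk⇔)
import Function.Construct.Symmetry as Symmetry
open import Level using (_⊔_) renaming (suc to lsuc)
open import Relation.Binary.Bundles using (Setoid)
open import Relation.Binary.Definitions using (_Respects_; tri<; tri≈; tri>)
open import Relation.Binary.PropositionalEquality as ≡ using ()
import Relation.Binary.Reasoning.Setoid as SetoidReasoning
open import Relation.Nullary.Decidable using (Dec; yes; no; map′; ¬?; decidable-stable; _×-dec_)
open import Relation.Nullary.Negation using (contradiction)
open import Relation.Unary using (Pred; _⊆_; Decidable)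

-- Orbits and first returns

module Orbits {a ℓ} (S : Setoid a ℓ) (f : Inverse S S) where

  open Setoid S
  open Dynamics S hiding (Transitive)

  -- x ⟶ y says that y lies on the forward orbit of x.
  infix 4 _⟶_
  _⟶_ : Carrier → Carrier → Set ℓ
  x ⟶ y = ∃[ k ] y ≈ (f ^ (+ k)) x

  ⟶-reflexive : ∀ {x y} → y ≈ x → x ⟶ y
  ⟶-reflexive y≈x = 0 , y≈x

  ⟶-trans : ∀ {x y z} → x ⟶ y → y ⟶ z → x ⟶ z
  ⟶-trans {x} (j , y≈) (k , z≈) = k ℕ.+ j , trans z≈ (trans (iterate-cong f k y≈) (sym (iterate-+ f k j x)))

  period-multiple : ∀ {x r} → (f ^ (+ r)) x ≈ x → ∀ c → (f ^ (+ (c ℕ.* r))) x ≈ x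
  period-multiple {x} {r} fʳx≈x zero    = refl
  period-multiple {x} {r} fʳx≈x (suc c) = trans (iterate-+ f r (c ℕ.* r) x)
    (trans (iterate-cong f r (period-multiple {r = r} fʳx≈x c)) fʳx≈x)

  transitive⇒⟶⊎⟵ : Transitive S f → ∀ x y → x ⟶ y ⊎ y ⟶ x
  transitive⇒⟶⊎⟵ f-transitive x y with f-transitive x y
  ... | + k , y≈      = inj₁ (k , y≈)
  ... | -[1+ k ] , y≈ = inj₂ (suc k , sym (trans (iterate-cong f (suc k) y≈) (unwind (Symmetry.inverse f) (suc k) x)))

  module _ (recurrent : Recurrent f) where

    -- Going round the period r of x often enough, k times, leaves k r - k further steps from y to x.
    ⟶-sym : ∀ {x y} → x ⟶ y → y ⟶ x
    ⟶-sym {x} {y} (k , y≈) with suc r , _ , fʳx≈x ← recurrent x = k ℕ.* suc r ∸ k , sym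
      (trans (iterate-cong f (k ℕ.* suc r ∸ k) y≈)
      (trans (sym (iterate-+ f (k ℕ.* suc r ∸ k) k x))
      (trans (reflexive (≡.cong (λ i → (f ^ (+ i)) x) (ℕ.m∸n+n≡m (ℕ.m≤m*n k (suc r)))))
             (period-multiple {r = suc r} fʳx≈x k))))

    transitive⇒⟶ : Transitive S f → ∀ x y → x ⟶ y
    transitive⇒⟶ f-transitive x y with transitive⇒⟶⊎⟵ f-transitive x y
    ... | inj₁ x⟶y = x⟶y
    ... | inj₂ y⟶x = ⟶-sym y⟶x

    -- An orbit is covered by one period, so whether it meets U can be decided.
    meets? : ∀ {p} {U : Pred Carrier p} → U Respects _≈_ → Decidable U →
             ∀ x → (∃[ k ] U ((f ^ (+ k)) x)) ⊎ (∀ k → ¬ U ((f ^ (+ k)) x))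
    meets? {U = U} U-resp U? x with suc r , _ , fʳx≈x ← recurrent x
      with search (λ k → U? ((f ^ (+ k)) x)) (suc r)
    ... | inj₁ (k , fᵏx∈U , _) = inj₁ (k , fᵏx∈U)
    ... | inj₂ none = inj₂ λ k fᵏx∈U → none (k % suc r) (m%n<n k (suc r)) (U-resp (reduced k) fᵏx∈U)
      where
      reduced : ∀ k → (f ^ (+ k)) x ≈ (f ^ (+ (k % suc r))) x
      reduced k = trans (reflexive (≡.cong (λ i → (f ^ (+ i)) x) (m≡m%n+[m/n]*n k (suc r))))
        (trans (iterate-+ f (k % suc r) _ x) (iterate-cong f (k % suc r) (period-multiple {r = suc r} fʳx≈x (k / suc r))))

-- A bijection ψ of X that π conjugates to the first return map of f to U.  Only the formula
-- for ψ is assumed; ψ itself is not built here, so that it applies to maps defined elsewhere.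
module FirstReturnOrbits {a ℓ} (S : Setoid a ℓ) {p} (U : Pred (Setoid.Carrier S) p)
    (U-resp : U Respects Setoid._≈_ S) (U? : Decidable U)
    (f : Inverse S S) (recurrent : Dynamics.Recurrent S f)
    {a′ ℓ′} (X : Setoid a′ ℓ′) where

  open Setoid S
  open Dynamics S hiding (Transitive)
  open FirstReturn U (λ {x} {y} → U-resp {x} {y}) U?
  open Orbits S f

  module _ (π : Inverse X Subset) (ψ : Inverse X X)
      (ψ-formula : ∀ x → Setoid._≈_ X (Inverse.to ψ x) (Inverse.from π (step f recurrent (Inverse.to π x)))) where

    open Inverse π using (to; to-cong; from-cong; strictlyInverseˡ; strictlyInverseʳ)
    module X = Setoid X
    module ψ = Orbits X ψ
    open Inverse ψ using () renaming (to to ψ⟨_⟩)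

    ⟨_⟩ : X.Carrier → Carrier
    ⟨ x ⟩ = proj₁ (to x)

    ψ-return : ∀ x → ⟨ ψ⟨ x ⟩ ⟩ ≈ proj₁ (step f recurrent (to x))
    ψ-return x = trans (to-cong (ψ-formula x)) (strictlyInverseˡ (step f recurrent (to x)))

    ψ-orbit⇒orbit : ∀ {x y} → x ψ.⟶ y → ⟨ x ⟩ ⟶ ⟨ y ⟩
    ψ-orbit⇒orbit {x} (j , y≈) = ⟶-trans (iterates j) (⟶-reflexive (to-cong y≈))
      where
      iterates : ∀ j → ⟨ x ⟩ ⟶ ⟨ Dynamics._^_ X ψ (+ j) x ⟩
      iterates zero    = ⟶-reflexive refl
      iterates (suc j) = ⟶-trans (iterates j) (proj₁ (firstReturnTime f recurrent ⟨ xⱼ ⟩ (proj₂ (to xⱼ))) , ψ-return xⱼ)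
        where xⱼ = Dynamics._^_ X ψ (+ j) x

    -- An f-orbit segment between two points of U decomposes into first returns: by strong
    -- induction on its length, split off the first return time, which is at most that length.
    orbit⇒ψ-orbit : ∀ {x y} → ⟨ x ⟩ ⟶ ⟨ y ⟩ → x ψ.⟶ y
    orbit⇒ψ-orbit {x} {y} (k , y≈) = <-rec P induct k x y≈
      where
      P : ℕ → Set _
      P k = ∀ x → ⟨ y ⟩ ≈ (f ^ (+ k)) ⟨ x ⟩ → x ψ.⟶ y
      induct : ∀ k → (∀ {j} → j < k → P j) → P k
      induct zero    rec x y≈ = 0 , X.trans (X.sym (strictlyInverseʳ y)) (X.trans (from-cong y≈) (strictlyInverseʳ x))
      induct (suc k) rec x y≈
        with firstReturnTime f recurrent ⟨ x ⟩ (proj₂ (to x)) | ψ-return x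
      ... | suc t , (1≤t , fᵗx∈U) , t-least | ψx≈ =
        ψ.⟶-trans (1 , X.refl) (rec (s≤s (ℕ.m∸n≤m k t)) ψ⟨ x ⟩ (trans y≈ split))
        where
        t≤k : suc t ≤ suc k
        t≤k = t-least (suc k) (s≤s z≤n , U-resp y≈ (proj₂ (to y)))
        split : (f ^ (+ suc k)) ⟨ x ⟩ ≈ (f ^ (+ (k ∸ t))) ⟨ ψ⟨ x ⟩ ⟩
        split = trans (reflexive (≡.cong (λ i → (f ^ (+ i)) ⟨ x ⟩) (≡.sym (ℕ.m∸n+n≡m t≤k))))
          (trans (iterate-+ f (k ∸ t) (suc t) ⟨ x ⟩) (iterate-cong f (k ∸ t) (sym ψx≈)))

    -- Transitivity allows negative powers of ψ; they are turned into positive powers of f by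
    -- recurrence.
    ψ-transitive⇔ : Transitive X ψ ⇔ (∀ (P Q : ∃ U) → proj₁ P ⟶ proj₁ Q)
    ψ-transitive⇔ = mk⇔ onU onX
      where
      onX : (∀ (P Q : ∃ U) → proj₁ P ⟶ proj₁ Q) → Transitive X ψ
      onX U-transitive x y with j , y≈ ← orbit⇒ψ-orbit {x} {y} (U-transitive (to x) (to y)) = + j , y≈
      onU : Transitive X ψ → ∀ (P Q : ∃ U) → proj₁ P ⟶ proj₁ Q
      onU ψ-transitive P Q =
        ⟶-trans (⟶-reflexive (strictlyInverseˡ P)) (⟶-trans (x⟶y _ _) (⟶-reflexive (sym (strictlyInverseˡ Q))))
        where
        x⟶y : ∀ x y → ⟨ x ⟩ ⟶ ⟨ y ⟩
        x⟶y x y with ψ.transitive⇒⟶⊎⟵ ψ-transitive x y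
        ... | inj₁ there = ψ-orbit⇒orbit there
        ... | inj₂ back  = ⟶-sym recurrent (ψ-orbit⇒orbit back)

module Jump {q c ℓ₁ ℓ₂} (F : FiniteField q c ℓ₁ ℓ₂) {n : ℕ} (Ψ : Geometry.Automorphism F n) where

  open Geometry F
  open Orbits (ℙ n) (action Ψ)

  jump-transitive⇔ : Transitive (𝔸 n) (fractionalJump Ψ) ⇔ (∀ (P Q : ∃ U) → proj₁ P ⟶ proj₁ Q)
  jump-transitive⇔ = FirstReturnOrbits.ψ-transitive⇔ (ℙ n) U (λ {P} {Q} → U-resp {n} {P} {Q}) U? (action Ψ)
    (recurrent (action Ψ)) (𝔸 n) π (fractionalJump Ψ) (λ x → Setoid.refl (𝔸 n) {Inverse.to (fractionalJump Ψ) x})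

-- Powers of 1 + w for nilpotent w

-- triangular j is the binomial coefficient of j over 2.
triangular : ℕ → ℕ
triangular zero    = 0
triangular (suc j) = j ℕ.+ triangular j

module PowersOfOnePlus {r ρ} (R : CommutativeRing r ρ) where

  open CommutativeRing R
  open Algebra.Properties.CommutativeSemiring.Exp commutativeSemiring
  open Algebra.Properties.Semiring.Mult semiring using (×-homo-+) renaming (_×_ to infixr 8 _·_)
  open Algebra.Solver.Ring.NaturalCoefficients.Default commutativeSemiring
  open SetoidReasoning setoid

  -- The binomial theorem, truncated after the quadratic term.
  cube-zero-power : ∀ {w} → w ^ 3 ≈ 0# → ∀ j →
                    (1# + w) ^ j ≈ 1# + (j · 1# * w + triangular j · 1# * (w * w))
  cube-zero-power {w} w³≈0 zero    = solve 1 (λ w → con 1 := con 1 :+ (con 0 :* w :+ con 0 :* (w :* w))) refl w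
  cube-zero-power {w} w³≈0 (suc j) = begin
    (1# + w) * (1# + w) ^ j
      ≈⟨ *-congˡ (cube-zero-power w³≈0 j) ⟩
    (1# + w) * (1# + (J * w + T * (w * w)))
      ≈⟨ solve 3 (λ w J T → (con 1 :+ w) :* (con 1 :+ (J :* w :+ T :* (w :* w)))
                   := con 1 :+ ((con 1 :+ J) :* w :+ (J :+ T) :* (w :* w)) :+ T :* (w :^ 3)) refl w J T ⟩
    1# + ((1# + J) * w + (J + T) * (w * w)) + T * w ^ 3
      ≈⟨ +-cong (+-congˡ (+-congˡ (*-congʳ (sym (×-homo-+ 1# j (triangular j)))))) (trans (*-congˡ w³≈0) (zeroʳ T)) ⟩
    1# + (suc j · 1# * w + triangular (suc j) · 1# * (w * w)) + 0#
      ≈⟨ +-identityʳ _ ⟩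
    1# + (suc j · 1# * w + triangular (suc j) · 1# * (w * w)) ∎
    where
    J = j · 1#
    T = triangular j · 1#

  annihilated-power : ∀ {w} j → w ^ 3 ≈ 0# → j · 1# ≈ 0# → triangular j · 1# * (w * w) ≈ 0# →
                      (1# + w) ^ j ≈ 1#
  annihilated-power {w} j w³≈0 j≈0 t≈0 = begin
    (1# + w) ^ j                                       ≈⟨ cube-zero-power w³≈0 j ⟩
    1# + (j · 1# * w + triangular j · 1# * (w * w))    ≈⟨ +-congˡ (+-cong (trans (*-congʳ j≈0) (zeroˡ w)) t≈0) ⟩
    1# + (0# + 0#)                                     ≈⟨ +-congˡ (+-identityʳ 0#) ⟩
    1# + 0#                                            ≈⟨ +-identityʳ 1# ⟩
    1#                                                 ∎

  double-power : ∀ x k → x ^ suc (suc k) ≈ 0# → x ^ suc k * x ^ suc k ≈ 0#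
  double-power x k eq = begin
    x ^ suc k * x ^ suc k     ≈⟨ solve 2 (λ x y → (x :* y) :* (x :* y) := x :* (x :* y) :* y) refl x (x ^ k) ⟩
    x ^ suc (suc k) * x ^ k   ≈⟨ *-congʳ eq ⟩
    0# * x ^ k                ≈⟨ zeroˡ _ ⟩
    0#                        ∎

  scale-squareZero : ∀ x {z} → z * z ≈ 0# → (x * z) * (x * z) ≈ 0#
  scale-squareZero x {z} z²≈0 = begin
    (x * z) * (x * z)   ≈⟨ solve 2 (λ x z → (x :* z) :* (x :* z) := x :* x :* (z :* z)) refl x z ⟩
    x * x * (z * z)     ≈⟨ *-congˡ z²≈0 ⟩
    x * x * 0#          ≈⟨ zeroʳ _ ⟩
    0#                  ∎

  square≈0 : ∀ {w} → w ^ 2 ≈ 0# → w * w ≈ 0#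
  square≈0 w²≈0 = trans (*-congˡ (sym (*-identityʳ _))) w²≈0

  ·1-+ : ∀ {j k} → j · 1# ≈ 0# → k · 1# ≈ 0# → (j ℕ.+ k) · 1# ≈ 0#
  ·1-+ {j} {k} j≈0 k≈0 = trans (×-homo-+ 1# j k) (trans (+-cong j≈0 k≈0) (+-identityˡ 0#))

-- Finite algebras whose units are scalar multiples of the powers of one element

-- A finite commutative F-algebra with a proper ideal W and an element a such that everything
-- outside W is a nonzero scalar times a power of a.  H is an additive set that contains W and
-- no nonzero scalar; in the application it is the set of elements x with x v in the
-- hyperplane at infinity.  Finiteness is given by an injective code, which need not respect
-- the equality of the ring, together with decidable equality.
record CyclicUnits {q c ℓ₁ ℓ₂} (F : FiniteField q c ℓ₁ ℓ₂) {r ρ} (R : CommutativeRing r ρ) (h : Level)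
    : Set (c ⊔ ℓ₁ ⊔ r ⊔ ρ ⊔ lsuc h) where

  module K = FiniteField F
  open CommutativeRing R
  open Algebra.Properties.CommutativeSemiring.Exp commutativeSemiring using (_^_)

  infix 4 _≈?_
  field
    ι        : K.Carrier → Carrier
    ι-cong   : ∀ {s t} → s K.≈ t → ι s ≈ ι t
    ι-+      : ∀ s t → ι (s K.+ t) ≈ ι s + ι t
    ι-*      : ∀ s t → ι (s K.* t) ≈ ι s * ι t
    ι-1      : ι K.1# ≈ 1#

    size           : ℕ
    code           : Carrier → Fin size
    code-injective : ∀ {x y} → code x ≡ code y → x ≈ y
    _≈?_           : ∀ x y → Dec (x ≈ y)

    H       : Pred Carrier h
    H-resp  : H Respects _≈_
    H-+     : ∀ {x y} → H x → H y → H (x + y)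
    H-ι     : ∀ {s} → H (ι s) → s K.≈ K.0#

    W       : Pred Carrier h
    W-resp  : W Respects _≈_
    W-+     : ∀ {x y} → W x → W y → W (x + y)
    W-*     : ∀ x {y} → W y → W (x * y)
    W⊆H     : W ⊆ H

  -- A nonzero element of the base field.
  Scalar : Pred Carrier (c ⊔ ℓ₁ ⊔ ρ)
  Scalar x = ∃[ s ] ¬ (s K.≈ K.0#) × x ≈ ι s

  field
    a       : Carrier
    period  : ∃[ t ] 1 ≤ t × Scalar (a ^ t)
    split   : ∀ x → W x ⊎ ∃[ s ] ∃[ k ] Scalar s × x ≈ s * a ^ k

module CyclicUnitsProperties {q c ℓ₁ ℓ₂} (F : FiniteField q c ℓ₁ ℓ₂) {r ρ} (R : CommutativeRing r ρ) {h}
    (cyclicUnits : CyclicUnits F R h) where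

  open CommutativeRing R hiding (zero)
  open CyclicUnits cyclicUnits
  open Algebra.Properties.CommutativeSemiring.Exp commutativeSemiring
  open Algebra.Properties.Ring ring using (-1*x≈-x; x+x≈x⇒x≈0)
  open Algebra.Properties.AbelianGroup +-abelianGroup using () renaming (∙-cancelˡ to +-cancelˡ)
  open Algebra.Solver.Ring.NaturalCoefficients.Default commutativeSemiring using (solve; _:=_; _:+_; _:*_)
  open SetoidReasoning setoid
  module G = Geometry F
  module E = Inverse K.enumeration

  ι-0 : ι K.0# ≈ 0#
  ι-0 = x+x≈x⇒x≈0 _ (trans (sym (ι-+ _ _)) (ι-cong (K.+-identityʳ K.0#)))

  Scalar-1 : Scalar 1#
  Scalar-1 = K.1# , G.nontrivial , sym ι-1

  Scalar-* : ∀ {x y} → Scalar x → Scalar y → Scalar (x * y)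
  Scalar-* (s , s≉0 , x≈s) (t , t≉0 , y≈t) = s K.* t , G.product≉0 s≉0 t≉0 , trans (*-cong x≈s y≈t) (sym (ι-* s t))

  Scalar-^ : ∀ {x} → Scalar x → ∀ k → Scalar (x ^ k)
  Scalar-^ sx zero    = Scalar-1
  Scalar-^ sx (suc k) = Scalar-* sx (Scalar-^ sx k)

  Scalar-resp : Scalar Respects _≈_
  Scalar-resp x≈y (s , s≉0 , x≈s) = s , s≉0 , trans (sym x≈y) x≈s

  Scalar-inverse : ∀ {x} → Scalar x → ∃[ y ] Scalar y × x * y ≈ 1#
  Scalar-inverse {x} (s , s≉0 , x≈s) with s⁻¹ , ss⁻¹≈1 ← G.reciprocal s s≉0 =
    ι s⁻¹ , (s⁻¹ , G.factor≉0 ss⁻¹≈1 , refl) ,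
    trans (*-congʳ x≈s) (trans (sym (ι-* s s⁻¹)) (trans (ι-cong ss⁻¹≈1) ι-1))

  cancel-inverse : ∀ {x y} z → x * y ≈ 1# → x * z * y ≈ z
  cancel-inverse {x} {y} z xy≈1 = begin
    x * z * y    ≈⟨ solve 3 (λ x y z → x :* z :* y := x :* y :* z) refl x y z ⟩
    x * y * z    ≈⟨ *-congʳ xy≈1 ⟩
    1# * z       ≈⟨ *-identityˡ z ⟩
    z            ∎

  Scalar-cancel : ∀ {x y} → Scalar x → Scalar (x * y) → Scalar y
  Scalar-cancel {x} {y} sx sxy with x⁻¹ , sx⁻¹ , xx⁻¹≈1 ← Scalar-inverse sx =
    Scalar-resp (cancel-inverse y xx⁻¹≈1) (Scalar-* sxy sx⁻¹)

  Scalar? : ∀ x → Dec (Scalar x)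
  Scalar? x = map′ (λ (i , s≉0 , x≈s) → E.from i , s≉0 , x≈s)
    (λ (s , s≉0 , x≈s) → let s≈ = K.sym (E.strictlyInverseʳ s) in
      E.to s , (λ s≈0 → s≉0 (K.trans s≈ s≈0)) , trans x≈s (ι-cong s≈))
    (Fin.any? λ i → ¬? (E.from i G.≈? K.0#) ×-dec (x ≈? ι (E.from i)))

  a-invertible : ∃[ b ] a * b ≈ 1#
  a-invertible with suc t , _ , sa ← period with y , _ , eq ← Scalar-inverse sa =
    a ^ t * y , trans (sym (*-assoc a (a ^ t) y)) eq

  ^-invertible : ∀ {x y} → x * y ≈ 1# → ∀ k → x ^ k * y ^ k ≈ 1#
  ^-invertible {x} {y} xy≈1 k = trans (sym (^-distrib-* x y k)) (trans (^-congˡ k xy≈1) (1^ k))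
    where
    1^ : ∀ k → 1# ^ k ≈ 1#
    1^ zero    = refl
    1^ (suc k) = trans (*-identityˡ _) (1^ k)

  1∉W : ¬ W 1#
  1∉W 1∈W = G.nontrivial (H-ι (H-resp (sym ι-1) (W⊆H 1∈W)))

  W-neg : ∀ {x} → W x → W (- x)
  W-neg x∈W = W-resp (-1*x≈-x _) (W-* (- 1#) x∈W)

  -- Hence the ring is local with maximal ideal W.
  W⊎unit : ∀ x → W x ⊎ ∃[ y ] x * y ≈ 1#
  W⊎unit x with split x
  ... | inj₁ x∈W = inj₁ x∈W
  ... | inj₂ (s , k , ss , x≈saᵏ) with t , _ , st≈1 ← Scalar-inverse ss | b , ab≈1 ← a-invertible =
    inj₂ (t * b ^ k , (begin
      x * (t * b ^ k)          ≈⟨ *-congʳ x≈saᵏ ⟩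
      s * a ^ k * (t * b ^ k)  ≈⟨ solve 4 (λ s x t y → s :* x :* (t :* y) := s :* t :* (x :* y)) refl s (a ^ k) t (b ^ k) ⟩
      s * t * (a ^ k * b ^ k)  ≈⟨ *-cong st≈1 (^-invertible ab≈1 k) ⟩
      1# * 1#                  ≈⟨ *-identityˡ 1# ⟩
      1#                       ∎))

  unit-cancel : ∀ {x x⁻¹ y} → x * x⁻¹ ≈ 1# → x * y ≈ 0# → y ≈ 0#
  unit-cancel {x} {x⁻¹} {y} xx⁻¹≈1 xy≈0 = begin
    y            ≈⟨ cancel-inverse y xx⁻¹≈1 ⟨
    x * y * x⁻¹  ≈⟨ *-congʳ xy≈0 ⟩
    0# * x⁻¹     ≈⟨ zeroˡ x⁻¹ ⟩
    0#           ∎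

  ∉W-cancel : ∀ {x y} → ¬ W x → x * y ≈ 0# → y ≈ 0#
  ∉W-cancel {x} x∉W xy≈0 with W⊎unit x
  ... | inj₁ x∈W        = contradiction x∈W x∉W
  ... | inj₂ (_ , eq)   = unit-cancel eq xy≈0

  zeroDivisor∈W : ∀ {x y} → ¬ (y ≈ 0#) → x * y ≈ 0# → W x
  zeroDivisor∈W {x} y≉0 xy≈0 with W⊎unit x
  ... | inj₁ x∈W        = x∈W
  ... | inj₂ (_ , eq)   = contradiction (unit-cancel eq xy≈0) y≉0

  cancel-sum : ∀ x y → x + y + - y ≈ x
  cancel-sum x y = trans (+-assoc x y (- y)) (trans (+-congˡ (-‿inverseʳ y)) (+-identityʳ x))

  1+w∉W : ∀ {w} → W w → ¬ W (1# + w)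
  1+w∉W w∈W 1+w∈W = 1∉W (W-resp (cancel-sum 1# _) (W-+ 1+w∈W (W-neg w∈W)))

  -- The scalars meet H, and hence W, only in 0, so an element of the sum of F and W has one scalar part.
  scalarPart : ∀ {s w w′} → W w → W w′ → ι s + w ≈ 1# + w′ → s K.≈ K.1#
  scalarPart {s} {w} {w′} w∈W w′∈W eq = s≈1
    where
    d = s K.- K.1#
    d+1≈s : d K.+ K.1# K.≈ s
    d+1≈s = K.trans (K.+-assoc s _ _) (K.trans (K.+-congˡ (K.-‿inverseˡ K.1#)) (K.+-identityʳ s))
    ιd+w≈w′ : ι d + w ≈ w′
    ιd+w≈w′ = +-cancelˡ 1# _ _ (begin
      1# + (ι d + w)       ≈⟨ solve 3 (λ x y z → x :+ (y :+ z) := y :+ x :+ z) refl 1# (ι d) w ⟩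
      ι d + 1# + w         ≈⟨ +-congʳ (trans (+-congˡ (sym ι-1)) (trans (sym (ι-+ d K.1#)) (ι-cong d+1≈s))) ⟩
      ι s + w              ≈⟨ eq ⟩
      1# + w′              ∎)
    d≈0 : d K.≈ K.0#
    d≈0 = H-ι (W⊆H (W-resp (cancel-sum (ι d) w) (W-+ (W-resp (sym ιd+w≈w′) w′∈W) (W-neg w∈W))))
    s≈1 : s K.≈ K.1#
    s≈1 = K.trans (K.sym d+1≈s) (K.trans (K.+-congʳ d≈0) (K.+-identityˡ K.1#))

  -- 1 + W embeds in the group of units modulo scalars.
  1+-injective-upToScalar : ∀ {w w′ s s′ x} → W w → W w′ → Scalar s → Scalar s′ →
                            1# + w ≈ s * x → 1# + w′ ≈ s′ * x → w ≈ w′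
  1+-injective-upToScalar {w} {w′} {s} {s′} {x} w∈W w′∈W ss ss′ eq eq′
    with t , st , st≈1 ← Scalar-inverse ss with λ′ , _ , ts′≈λ ← Scalar-* st ss′ =
    +-cancelˡ 1# _ _ (begin
      1# + w             ≈⟨ *-identityˡ _ ⟨
      1# * (1# + w)      ≈⟨ *-congʳ (trans (ι-cong λ≈1) ι-1) ⟨
      ι λ′ * (1# + w)    ≈⟨ scaled ⟩
      1# + w′            ∎)
    where
    scaled : ι λ′ * (1# + w) ≈ 1# + w′
    scaled = begin
      ι λ′ * (1# + w)       ≈⟨ *-cong (sym ts′≈λ) eq ⟩
      t * s′ * (s * x)      ≈⟨ solve 4 (λ t s′ s x → t :* s′ :* (s :* x) := s :* (s′ :* x) :* t) refl t s′ s x ⟩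
      s * (s′ * x) * t      ≈⟨ cancel-inverse _ st≈1 ⟩
      s′ * x                ≈⟨ eq′ ⟨
      1# + w′               ∎
    λ≈1 : λ′ K.≈ K.1#
    λ≈1 = scalarPart (W-* (ι λ′) w∈W) w′∈W
      (trans (+-congʳ (sym (*-identityʳ _))) (trans (sym (distribˡ _ _ _)) scaled))

  -- The least such k is the order T of a in the group of units modulo scalars; every power of a
  -- equals, up to a scalar, one with exponent below T.
  IsScalarPower : Pred ℕ _
  IsScalarPower k = 1 ≤ k × Scalar (a ^ k)

  scalarOrder : ∃[ T ] IsLeast IsScalarPower T
  scalarOrder = least (λ k → (1 ℕ.≤? k) ×-dec Scalar? (a ^ k)) period

  T : ℕ
  T = proj₁ scalarOrder

  aᵀ-scalar : Scalar (a ^ T)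
  aᵀ-scalar = proj₂ (proj₁ (proj₂ scalarOrder))

  instance
    T-nonZero : NonZero T
    T-nonZero = >-nonZero (proj₁ (proj₁ (proj₂ scalarOrder)))

  reduce : ∀ k → ∃[ s ] Scalar s × a ^ k ≈ s * a ^ (k % T)
  reduce k = (a ^ T) ^ (k / T) , Scalar-^ aᵀ-scalar (k / T) , (begin
    a ^ k                                  ≈⟨ ^-congʳ a (≡.trans (m≡m%n+[m/n]*n k T) (ℕ.+-comm (k % T) _)) ⟩
    a ^ (k / T ℕ.* T ℕ.+ k % T)            ≈⟨ ^-homo-* a (k / T ℕ.* T) (k % T) ⟩
    a ^ (k / T ℕ.* T) * a ^ (k % T)        ≈⟨ *-congʳ (^-congʳ a (ℕ.*-comm (k / T) T)) ⟩
    a ^ (T ℕ.* (k / T)) * a ^ (k % T)      ≈⟨ *-congʳ (^-assocʳ a T (k / T)) ⟨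
    (a ^ T) ^ (k / T) * a ^ (k % T)        ∎)

  order-divides : ∀ {k} → Scalar (a ^ k) → T ∣ k
  order-divides {k} sk with k % T in eq | reduce k
  ... | zero  | _ = m%n≡0⇒n∣m k T eq
  ... | suc r | s , ss , aᵏ≈ = contradiction (m%n<n k T)
    (ℕ.≤⇒≯ (≡.subst (T ≤_) (≡.sym eq) (proj₂ (proj₂ scalarOrder) (suc r) (s≤s z≤n , Scalar-cancel ss (Scalar-resp aᵏ≈ sk)))))

  -- The elements w of W for which 1 + w has order dividing n.
  Torsion : ℕ → Pred Carrier _
  Torsion n w = W w × (1# + w) ^ n ≈ 1#

  -- Write 1 + w = s aʳ with r < T.  If its n-th power is 1 then T divides r n, and the quotient d
  -- is below n; since n is not 0, d determines r, and r determines w.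
  torsionIndex : ∀ {n} .{{_ : NonZero n}} {w} → Torsion n w →
    ∃[ d ] ∃[ r ] ∃[ s ] d < n × r ℕ.* n ≡ d ℕ.* T × Scalar s × 1# + w ≈ s * a ^ r
  torsionIndex {n} {w} (w∈W , pw≈1) with split (1# + w)
  ... | inj₁ 1+w∈W = contradiction 1+w∈W (1+w∉W w∈W)
  ... | inj₂ (s , k , ss , 1+w≈saᵏ) with t , st , aᵏ≈taʳ ← reduce k =
    d , k % T , s * t , d<n , rn≡dT , Scalar-* ss st , 1+w≈
    where
    1+w≈ : 1# + w ≈ s * t * a ^ (k % T)
    1+w≈ = trans 1+w≈saᵏ (trans (*-congˡ aᵏ≈taʳ) (sym (*-assoc s t _)))
    T∣rn : T ∣ k % T ℕ.* n
    T∣rn = order-divides (Scalar-cancel (Scalar-^ (Scalar-* ss st) n) (Scalar-resp (begin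
      1#                                  ≈⟨ pw≈1 ⟨
      (1# + w) ^ n                        ≈⟨ ^-congˡ n 1+w≈ ⟩
      (s * t * a ^ (k % T)) ^ n           ≈⟨ ^-distrib-* (s * t) _ n ⟩
      (s * t) ^ n * (a ^ (k % T)) ^ n     ≈⟨ *-congˡ (^-assocʳ a (k % T) n) ⟩
      (s * t) ^ n * a ^ (k % T ℕ.* n)     ∎) Scalar-1))
    d = _∣_.quotient T∣rn
    rn≡dT : k % T ℕ.* n ≡ d ℕ.* T
    rn≡dT = _∣_.equality T∣rn
    d<n : d < n
    d<n = ℕ.*-cancelʳ-< T d n (≡.subst₂ _<_ rn≡dT (ℕ.*-comm T n) (ℕ.*-monoˡ-< n (m%n<n k T)))

  -- In a cyclic group at most n elements have order dividing n.
  torsion-bound : ∀ {n m} .{{_ : NonZero n}} (f : Fin m → Carrier) → (∀ {i j} → f i ≈ f j → i ≡ j) →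
                  (∀ i → Torsion n (f i)) → m ≤ n
  torsion-bound {n} {m} f f-injective f-torsion = Fin.injective⇒≤ {f = index} index-injective
    where
    index : Fin m → Fin n
    index i = let d , r , s , d<n , _ = torsionIndex (f-torsion i) in fromℕ< d<n
    index-injective : ∀ {i j} → index i ≡ index j → i ≡ j
    index-injective {i} {j} same
      with d , r , s , d<n , rn≡dT , ss , eq ← torsionIndex (f-torsion i)
         | d′ , r′ , s′ , d′<n , r′n≡d′T , ss′ , eq′ ← torsionIndex (f-torsion j)
      with ≡.refl ← Fin.fromℕ<-injective d d′ d<n d′<n same
      with ≡.refl ← ℕ.*-cancelʳ-≡ r r′ n (≡.trans rn≡dT (≡.sym r′n≡d′T)) =
      f-injective (1+-injective-upToScalar (proj₁ (f-torsion i)) (proj₁ (f-torsion j)) ss ss′ eq eq′)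

-- The structure of such algebras

-- For odd j = 1 + 2m the binomial coefficient of j over 2 is j m, a multiple of j.
triangular-odd : ∀ m → triangular (suc (m ℕ.+ m)) ≡ suc (m ℕ.+ m) ℕ.* m
triangular-odd zero    = ≡.refl
triangular-odd (suc m) rewrite ℕ.+-suc m m | triangular-odd m =
  solve 1 (λ m → (con 2 :+ (m :+ m)) :+ ((con 1 :+ (m :+ m)) :+ (con 1 :+ (m :+ m)) :* m)
              := (con 3 :+ (m :+ m)) :* (con 1 :+ m)) ≡.refl m
  where open Data.Nat.Solver.+-*-Solver

prime-parity : ∀ {p} → Prime p → p ≡ 2 ⊎ ∃[ m ] p ≡ suc (m ℕ.+ m)
prime-parity {p} p-prime with p % 2 in p%2≡ | m≡m%n+[m/n]*n p 2 | m%n<n p 2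
... | zero        | eq | _ with prime⇒irreducible p-prime (m%n≡0⇒n∣m p 2 p%2≡)
...   | inj₂ 2≡p = inj₁ (≡.sym 2≡p)
prime-parity {p} p-prime | suc zero | eq | _ = inj₂ (p / 2 , ≡.trans eq (≡.cong suc (≡.trans (ℕ.*-comm (p / 2) 2) (≡.cong (p / 2 ℕ.+_) (ℕ.+-identityʳ _)))))
prime-parity {p} p-prime | suc (suc _) | eq | s≤s (s≤s ())

module CyclicUnitsStructure {q c ℓ₁ ℓ₂} (F : FiniteField q c ℓ₁ ℓ₂) {r ρ} (R : CommutativeRing r ρ) {h}
    (cyclicUnits : CyclicUnits F R h) where

  open CommutativeRing R hiding (zero)
  open CyclicUnits cyclicUnits
  open CyclicUnitsProperties F R cyclicUnits
  open Algebra.Properties.CommutativeSemiring.Exp commutativeSemiring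
  open Algebra.Properties.Semiring.Mult semiring using (×1-homo-*) renaming (_×_ to infixr 8 _·_)
  open Algebra.Properties.Ring ring using (-‿distribˡ-*)
  open Algebra.Properties.AbelianGroup +-abelianGroup using () renaming (∙-cancelʳ to +-cancelʳ; ∙-cancelˡ to +-cancelˡ)
  open Algebra.Solver.Ring.NaturalCoefficients.Default commutativeSemiring using (solve; _:=_; _:*_; _:^_)
  open PowersOfOnePlus R
  open SetoidReasoning setoid

  W-^ : ∀ {w} → W w → ∀ k → W (w ^ suc k)
  W-^ w∈W k = W-resp (*-comm _ _) (W-* _ w∈W)

  -- Two powers of w agree, say wⁱ = wⁱ⁺ᵈ with d positive, and 1 - wᵈ is a unit because wᵈ lies
  -- in W.
  nilpotent : ∀ {w} → W w → ∃[ k ] w ^ k ≈ 0#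
  nilpotent {w} w∈W
    with i , j , i<j , same ← Fin.pigeonhole (ℕ.n<1+n size) (λ i → code (w ^ toℕ i))
    with toℕ j ∸ toℕ i in eq | ℕ.m<n⇒0<n∸m i<j
  ... | suc d | _ = toℕ i , ∉W-cancel 1-wᵈ∉W (begin
      (1# - w ^ suc d) * w ^ toℕ i                      ≈⟨ distribʳ _ _ _ ⟩
      1# * w ^ toℕ i + - (w ^ suc d) * w ^ toℕ i        ≈⟨ +-cong (*-identityˡ _) (sym (-‿distribˡ-* _ _)) ⟩
      w ^ toℕ i - w ^ suc d * w ^ toℕ i                 ≈⟨ +-congˡ (-‿cong (^-homo-* w (suc d) (toℕ i))) ⟨
      w ^ toℕ i - w ^ (suc d ℕ.+ toℕ i)                 ≈⟨ +-congˡ (-‿cong (^-congʳ w 1+d+i≡j)) ⟩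
      w ^ toℕ i - w ^ toℕ j                             ≈⟨ +-congˡ (-‿cong (code-injective same)) ⟨
      w ^ toℕ i - w ^ toℕ i                             ≈⟨ -‿inverseʳ _ ⟩
      0#                                                ∎)
    where
    1-wᵈ∉W : ¬ W (1# - w ^ suc d)
    1-wᵈ∉W = 1+w∉W (W-neg (W-^ w∈W d))
    1+d+i≡j : suc d ℕ.+ toℕ i ≡ toℕ j
    1+d+i≡j = ≡.trans (≡.cong (ℕ._+ toℕ i) (≡.sym eq)) (ℕ.m∸n+n≡m (ℕ.<⇒≤ i<j))

  nilpotencyIndex : ∀ {w} → W w → ∃[ k ] IsLeast (λ k → w ^ k ≈ 0#) k
  nilpotencyIndex {w} w∈W = least (λ k → (w ^ k) ≈? 0#) (nilpotent w∈W)

  0∈W : ∀ {w} → W w → W 0#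
  0∈W w∈W = W-resp (zeroˡ _) (W-* 0# w∈W)

  1≉0 : ∀ {w} → W w → ¬ (1# ≈ 0#)
  1≉0 w∈W 1≈0 = 1∉W (W-resp (sym 1≈0) (0∈W w∈W))

  -- The last nonzero power of w; its exponent is positive.
  squareZero : ∀ {w} → W w → ¬ (w ≈ 0#) → ∃[ z ] W z × ¬ (z ≈ 0#) × z * z ≈ 0#
  squareZero {w} w∈W w≉0 with nilpotencyIndex w∈W
  ... | zero        , 1≈0 , _           = contradiction 1≈0 (1≉0 w∈W)
  ... | suc zero    , w≈0 , _           = contradiction (trans (sym (*-identityʳ w)) w≈0) w≉0
  ... | suc (suc k) , wᵏ⁺²≈0 , minimal  =
    w ^ suc k , W-^ w∈W k , (λ wᵏ⁺¹≈0 → ℕ.<⇒≱ (ℕ.n<1+n _) (minimal _ wᵏ⁺¹≈0)) , double-power w k wᵏ⁺²≈0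

  multiple-injective : ∀ {z s t} → ¬ (z ≈ 0#) → ι s * z ≈ ι t * z → s K.≈ t
  multiple-injective {z} {s} {t} z≉0 eq = Algebra.Properties.Group.x∙y⁻¹≈ε⇒x≈y (CommutativeRing.+-group K.commutativeRing) s t
    (H-ι (W⊆H (zeroDivisor∈W z≉0 (+-cancelʳ (ι t * z) _ _ (begin
      ι (s K.- t) * z + ι t * z   ≈⟨ distribʳ _ _ _ ⟨
      (ι (s K.- t) + ι t) * z     ≈⟨ *-congʳ (trans (sym (ι-+ _ _)) (ι-cong (K.trans (K.+-assoc s _ t) (K.trans (K.+-congˡ (K.-‿inverseˡ t)) (K.+-identityʳ s))))) ⟩
      ι s * z                     ≈⟨ eq ⟩
      ι t * z                     ≈⟨ +-identityˡ _ ⟨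
      0# + ι t * z                ∎)))))

  -- From here on p is the characteristic and q a power of p; that q is at least p is all that is
  -- needed of the latter.
  module _ {p : ℕ} (p-prime : Prime p) (p≤q : p ≤ q) (char : p · 1# ≈ 0#) where

    instance
      p-nonZero : NonZero p
      p-nonZero = prime⇒nonZero p-prime

    squareZero⇒torsion : ∀ {w} → W w → w * w ≈ 0# → Torsion p w
    squareZero⇒torsion {w} w∈W w²≈0 = w∈W , annihilated-power p
      (trans (solve 1 (λ w → w :^ 3 := w :* (w :* w)) refl w) (trans (*-congˡ w²≈0) (zeroʳ w)))
      char (trans (*-congˡ w²≈0) (zeroʳ _))

    module _ {z : Carrier} (z∈W : W z) (z≉0 : ¬ (z ≈ 0#)) (z²≈0 : z * z ≈ 0#) where

      multiple : Fin q → Carrier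
      multiple i = ι (E.from i) * z

      multiple-distinct : ∀ {i j} → multiple i ≈ multiple j → i ≡ j
      multiple-distinct {i} {j} eq = ≡.trans (≡.sym (E.strictlyInverseˡ i))
        (≡.trans (E.to-cong (multiple-injective z≉0 eq)) (E.strictlyInverseˡ j))

      multiple-torsion : ∀ i → Torsion p (multiple i)
      multiple-torsion i = squareZero⇒torsion (W-* _ z∈W) (scale-squareZero _ z²≈0)

      q≤p : q ≤ p
      q≤p = torsion-bound multiple multiple-distinct multiple-torsion

      -- Otherwise y and the q multiples of z would be q + 1 > p elements of p-torsion.
      torsion⇒multiple : ∀ {y} → Torsion p y → ∃[ s ] y ≈ ι s * z
      torsion⇒multiple {y} y-torsion = decidable-stable
        (map′ (λ (i , eq) → E.from i , eq)
              (λ (s , eq) → E.to s , trans eq (*-congʳ (ι-cong (K.sym (E.strictlyInverseʳ s)))))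
              (Fin.any? λ i → y ≈? multiple i))
        λ none → ℕ.<⇒≱ (ℕ.n<1+n q) (ℕ.≤-trans (torsion-bound extended (distinct none) extended-torsion) p≤q)
        where
        extended : Fin (suc q) → Carrier
        extended zero    = y
        extended (suc i) = multiple i
        extended-torsion : ∀ i → Torsion p (extended i)
        extended-torsion zero    = y-torsion
        extended-torsion (suc i) = multiple-torsion i
        distinct : ¬ (∃[ s ] y ≈ ι s * z) → ∀ {i j} → extended i ≈ extended j → i ≡ j
        distinct none {zero}  {zero}  eq = ≡.refl
        distinct none {zero}  {suc j} eq = contradiction (_ , eq) none
        distinct none {suc i} {zero}  eq = contradiction (_ , sym eq) none
        distinct none {suc i} {suc j} eq = ≡.cong suc (multiple-distinct eq)

      -- For z as above, a acts on z as a scalar α, and g = a - α.  Only these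
      -- two equations are used, whichever way α was found.
      module _ {α : K.Carrier} {g : Carrier} (a≈α+g : a ≈ ι α + g) (gz≈0 : g * z ≈ 0#) where

        g∈W : W g
        g∈W = zeroDivisor∈W z≉0 gz≈0

        -- R = F + gR, because a is congruent to α modulo g.
        aᵏ-expansion : ∀ k → ∃[ s ] ∃[ u ] a ^ k ≈ ι s + u * g
        aᵏ-expansion zero    = K.1# , 0# , (begin
          1#               ≈⟨ +-identityʳ 1# ⟨
          1# + 0#          ≈⟨ +-cong ι-1 (zeroˡ g) ⟨
          ι K.1# + 0# * g  ∎)
        aᵏ-expansion (suc k) with s , u , eq ← aᵏ-expansion k =
          α K.* s , ι α * u + a ^ k , (begin
            a * a ^ k                                ≈⟨ *-congʳ a≈α+g ⟩
            (ι α + g) * a ^ k                        ≈⟨ distribʳ _ _ _ ⟩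
            ι α * a ^ k + g * a ^ k                  ≈⟨ +-cong (*-congˡ eq) (*-comm g _) ⟩
            ι α * (ι s + u * g) + a ^ k * g          ≈⟨ +-congʳ (distribˡ _ _ _) ⟩
            ι α * ι s + ι α * (u * g) + a ^ k * g    ≈⟨ +-assoc _ _ _ ⟩
            ι α * ι s + (ι α * (u * g) + a ^ k * g)  ≈⟨ +-congˡ (+-congʳ (*-assoc _ _ _)) ⟨
            ι α * ι s + (ι α * u * g + a ^ k * g)    ≈⟨ +-cong (ι-* α s) (distribʳ _ _ _) ⟨
            ι (α K.* s) + (ι α * u + a ^ k) * g      ∎)

        expansion : ∀ {x} → (∃[ s ] ∃[ k ] Scalar s × x ≈ s * a ^ k) → ∃[ s ] ∃[ u ] x ≈ ι s + u * g
        expansion {x} (s , k , (s′ , _ , s≈s′) , x≈) with t , u , eq ← aᵏ-expansion k = s′ K.* t , s * u , (begin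
          x                         ≈⟨ x≈ ⟩
          s * a ^ k                 ≈⟨ *-congˡ eq ⟩
          s * (ι t + u * g)         ≈⟨ trans (distribˡ s _ _) (+-congˡ (sym (*-assoc s u g))) ⟩
          s * ι t + s * u * g       ≈⟨ +-congʳ (*-congʳ s≈s′) ⟩
          ι s′ * ι t + s * u * g    ≈⟨ +-congʳ (ι-* s′ t) ⟨
          ι (s′ K.* t) + s * u * g  ∎)

        W-principal : ∀ {w} → W w → ∃[ u ] w ≈ u * g
        W-principal {w} w∈W with split (1# + w)
        ... | inj₁ 1+w∈W = contradiction 1+w∈W (1+w∉W w∈W)
        ... | inj₂ form with s , u , eq ← expansion form = u , +-cancelˡ 1# _ _ (begin
          1# + w        ≈⟨ eq ⟩
          ι s + u * g   ≈⟨ +-congʳ (trans (ι-cong (scalarPart (W-* u g∈W) w∈W (sym eq))) ι-1) ⟩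
          1# + u * g    ∎)

        -- If x = s + u g lies in H then so does the scalar s, which is therefore 0.
        H⊆W : H ⊆ W
        H⊆W {x} x∈H with split x
        ... | inj₁ x∈W  = x∈W
        ... | inj₂ form with s , u , eq ← expansion form = W-resp (sym (begin
          x               ≈⟨ eq ⟩
          ι s + u * g     ≈⟨ +-congʳ (trans (ι-cong s≈0) ι-0) ⟩
          0# + u * g      ≈⟨ +-identityˡ _ ⟩
          u * g           ∎)) (W-* u g∈W)
          where
          s≈0 : s K.≈ K.0#
          s≈0 = H-ι (H-resp (cancel-sum (ι s) (u * g)) (H-+ (H-resp eq x∈H) (W⊆H (W-neg (W-* u g∈W)))))

        power-zero : ∀ k → g ^ k ≈ 0# → ∀ {w} → W w → w ^ k ≈ 0#
        power-zero k gᵏ≈0 {w} w∈W with u , w≈ug ← W-principal w∈W = begin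
          w ^ k           ≈⟨ ^-congˡ k w≈ug ⟩
          (u * g) ^ k     ≈⟨ ^-distrib-* u g k ⟩
          u ^ k * g ^ k   ≈⟨ *-congˡ gᵏ≈0 ⟩
          u ^ k * 0#      ≈⟨ zeroʳ _ ⟩
          0#              ∎

        -- The p-torsion consists of multiples of z, and g z = 0.
        torsion-annihilated : ∀ {y} → Torsion p y → g * y ≈ 0#
        torsion-annihilated {y} y-torsion with s , y≈sz ← torsion⇒multiple y-torsion = begin
          g * y             ≈⟨ *-congˡ y≈sz ⟩
          g * (ι s * z)     ≈⟨ solve 3 (λ g s z → g :* (s :* z) := s :* (g :* z)) refl g (ι s) z ⟩
          ι s * (g * z)     ≈⟨ *-congˡ gz≈0 ⟩
          ι s * 0#          ≈⟨ zeroʳ _ ⟩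
          0#                ∎

        -- The binomial coefficients 4 and 6 are even.
        fourth-torsion : 2 · 1# ≈ 0# → ∀ {w} → W w → w ^ 3 ≈ 0# → Torsion 4 w
        fourth-torsion 2≈0 w∈W w³≈0 = w∈W , annihilated-power 4 w³≈0 4≈0
          (trans (*-congʳ (·1-+ {4} {2} 4≈0 2≈0)) (zeroˡ _))
          where
          4≈0 : 4 · 1# ≈ 0#
          4≈0 = ·1-+ {2} {2} 2≈0 2≈0

        odd-torsion : ∀ {m} → p ≡ suc (m ℕ.+ m) → ∀ {w} → W w → w ^ 3 ≈ 0# → Torsion p w
        odd-torsion {m} ≡.refl w∈W w³≈0 = w∈W , annihilated-power p w³≈0 char (trans (*-congʳ (begin
          triangular p · 1#     ≡⟨ ≡.cong (_· 1#) (triangular-odd m) ⟩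
          (p ℕ.* m) · 1#        ≈⟨ ×1-homo-* p m ⟩
          p · 1# * m · 1#       ≈⟨ *-congʳ char ⟩
          0# * m · 1#           ≈⟨ zeroˡ _ ⟩
          0#                    ∎)) (zeroˡ _))

        -- The cases are those of the least exponent r with gʳ = 0.  As W is nonzero and consists of
        -- multiples of g, r is at least 2.
        H-bound : ∀ {m} (f : Fin m → Carrier) → (∀ {i j} → f i ≈ f j → i ≡ j) → (∀ i → H (f i)) →
                  m ≤ p ⊎ (p ≡ 2 × m ≤ 4)
        H-bound f f-injective f∈H with nilpotencyIndex g∈W
        ... | 0 , 1≈0 , _ = contradiction 1≈0 (1≉0 z∈W)
        ... | 1 , g≈0 , _ = contradiction (trans (sym (*-identityʳ z)) (power-zero 1 g≈0 z∈W)) z≉0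
        ... | 2 , g²≈0 , _ = inj₁ (torsion-bound f f-injective λ i →
          squareZero⇒torsion (H⊆W (f∈H i)) (square≈0 (power-zero 2 g²≈0 (H⊆W (f∈H i)))))
        ... | 3 , g³≈0 , minimal with prime-parity p-prime
        ...   | inj₁ ≡.refl = inj₂ (≡.refl , torsion-bound f f-injective λ i →
          fourth-torsion char (H⊆W (f∈H i)) (power-zero 3 g³≈0 (H⊆W (f∈H i))))
        ...   | inj₂ (m , p≡1+2m) = contradiction
          (minimal 2 (trans (*-congˡ (*-identityʳ g)) (torsion-annihilated (odd-torsion {m} p≡1+2m g∈W g³≈0)))) λ { (s≤s (s≤s ())) }
        H-bound f f-injective f∈H | suc (suc (suc (suc k))) , gʳ≈0 , minimal =
          contradiction (minimal (3 ℕ.+ k) (torsion-annihilated (squareZero⇒torsion (W-^ g∈W (suc k)) y²≈0)))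
            (ℕ.<⇒≱ (ℕ.n<1+n _))
          where
          y²≈0 : g ^ (2 ℕ.+ k) * g ^ (2 ℕ.+ k) ≈ 0#
          y²≈0 = begin
            g ^ (2 ℕ.+ k) * g ^ (2 ℕ.+ k)  ≈⟨ solve 2 (λ g x → (g :* (g :* x)) :* (g :* (g :* x)) := g :* (g :* (g :* (g :* x))) :* x) refl g (g ^ k) ⟩
            g ^ (4 ℕ.+ k) * g ^ k          ≈⟨ *-congʳ gʳ≈0 ⟩
            0# * g ^ k                     ≈⟨ zeroˡ _ ⟩
            0#                             ∎

      H-dichotomy : ∀ {m} (f : Fin m → Carrier) → (∀ {i j} → f i ≈ f j → i ≡ j) → (∀ i → H (f i)) →
                    m ≤ p ⊎ (p ≡ 2 × m ≤ 4)
      H-dichotomy f = fromEigenvalue (torsion⇒multiple (squareZero⇒torsion (W-* a z∈W) (scale-squareZero a z²≈0)))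
        where
        fromEigenvalue : ∃[ α ] a * z ≈ ι α * z → _
        fromEigenvalue (α , az≈αz) = H-bound (begin
            a                  ≈⟨ cancel-sum a (ι α) ⟨
            a + ι α - ι α      ≈⟨ +-congʳ (+-comm a (ι α)) ⟩
            ι α + a - ι α      ≈⟨ +-assoc (ι α) a _ ⟩
            ι α + (a - ι α)    ∎) (begin
            (a - ι α) * z           ≈⟨ distribʳ _ _ _ ⟩
            a * z + - ι α * z       ≈⟨ +-cong az≈αz (sym (-‿distribˡ-* _ _)) ⟩
            ι α * z - ι α * z       ≈⟨ -‿inverseʳ _ ⟩
            0#                      ∎) f

  -- The conclusion: a nonzero W forces q to be prime and H to be small.
  nonzero-W-bounds : ∀ {p} → Prime p → p ≤ q → p · 1# ≈ 0# → ∀ {w} → W w → ¬ (w ≈ 0#) →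
              ∀ {m} (f : Fin m → Carrier) → (∀ {i j} → f i ≈ f j → i ≡ j) → (∀ i → H (f i)) →
              q ≤ p × (m ≤ p ⊎ (p ≡ 2 × m ≤ 4))
  nonzero-W-bounds p-prime p≤q char w∈W w≉0 f f-injective f∈H with z , z∈W , z≉0 , z²≈0 ← squareZero w∈W w≉0 =
    q≤p p-prime p≤q char z∈W z≉0 z²≈0 , H-dichotomy p-prime p≤q char z∈W z≉0 z²≈0 f f-injective f∈H

-- The characteristic of a finite field

injective⇒surjective : ∀ {n} {f : Fin n → Fin n} → (∀ {i j} → f i ≡ f j → i ≡ j) → ∀ y → ∃[ x ] f x ≡ y
injective⇒surjective {n} {f} f-injective y = decidable-stable (Fin.any? λ x → f x Fin.≟ y) λ none →
  ℕ.1+n≰n (Fin.injective⇒≤ {f = extended} (extended-injective none))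
  where
  extended : Fin (suc n) → Fin n
  extended zero    = y
  extended (suc i) = f i
  extended-injective : ¬ (∃[ x ] f x ≡ y) → ∀ {i j} → extended i ≡ extended j → i ≡ j
  extended-injective none {zero}  {zero}  eq = ≡.refl
  extended-injective none {zero}  {suc j} eq = contradiction (j , ≡.sym eq) none
  extended-injective none {suc i} {zero}  eq = contradiction (i , eq) none
  extended-injective none {suc i} {suc j} eq = ≡.cong suc (f-injective eq)

module Characteristic {q c ℓ₁ ℓ₂} (F : FiniteField q c ℓ₁ ℓ₂) where

  open FiniteField F hiding (zero)
  open Geometry F using (E-injective; _≈?_; nontrivial; product≉0)
  open Algebra.Properties.Semiring.Sum (CommutativeRing.semiring commutativeRing)
  open Algebra.Properties.Semiring.Mult (CommutativeRing.semiring commutativeRing)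
    using (×1-homo-*; ×-homo-+) renaming (_×_ to infixr 8 _·_)
  open Algebra.Properties.AbelianGroup (CommutativeRing.+-abelianGroup commutativeRing) using () renaming (∙-cancelˡ to +-cancelˡ)
  open SetoidReasoning setoid
  private module E = Inverse enumeration

  -- Translation by 1 permutes the field, so the sum of all elements absorbs q copies of 1.
  q·1≈0 : q · 1# ≈ 0#
  q·1≈0 = +-cancelˡ (sum E.from) _ _ (begin
    sum E.from + q · 1#                             ≈⟨ +-congˡ (sum-replicate q) ⟨
    sum E.from + ∑[ i < q ] 1#                      ≈⟨ ∑-distrib-+ E.from (λ _ → 1#) ⟨
    ∑[ i < q ] (E.from i + 1#)                      ≈⟨ sum-cong-≋ (λ i → E.strictlyInverseʳ (E.from i + 1#)) ⟨
    ∑[ i < q ] E.from (E.to (E.from i + 1#))        ≈⟨ ∑-permute E.from translation ⟨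
    sum E.from                                      ≈⟨ +-identityʳ _ ⟨
    sum E.from + 0#                                 ∎)
    where
    shift-back : ∀ x y → y + x ≈ 0# → ∀ i → E.to (E.from (E.to (E.from i + y)) + x) ≡ i
    shift-back x y y+x≈0 i = ≡.trans (E.to-cong (begin
      E.from (E.to (E.from i + y)) + x   ≈⟨ +-congʳ (E.strictlyInverseʳ _) ⟩
      E.from i + y + x                   ≈⟨ +-assoc _ y x ⟩
      E.from i + (y + x)                 ≈⟨ +-congˡ y+x≈0 ⟩
      E.from i + 0#                      ≈⟨ +-identityʳ _ ⟩
      E.from i                           ∎)) (E.strictlyInverseˡ i)
    translation = permutation (λ i → E.to (E.from i + 1#)) (λ i → E.to (E.from i - 1#))
      (shift-back 1# (- 1#) (-‿inverseˡ 1#)) (shift-back (- 1#) 1# (-‿inverseʳ 1#))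

  -- A field has no zero divisors.
  ^·1≈0 : ∀ p e → (p ℕ.^ e) · 1# ≈ 0# → p · 1# ≈ 0#
  ^·1≈0 p zero    1·1≈0  = contradiction (trans (sym (+-identityʳ 1#)) 1·1≈0) nontrivial
  ^·1≈0 p (suc e) pᵉ⁺¹≈0 with p · 1# ≈? 0# | (p ℕ.^ e) · 1# ≈? 0#
  ... | yes p≈0 | _       = p≈0
  ... | no _    | yes pᵉ≈0 = ^·1≈0 p e pᵉ≈0
  ... | no p≉0  | no pᵉ≉0 = contradiction (trans (sym (×1-homo-* p (p ℕ.^ e))) pᵉ⁺¹≈0) (product≉0 p≉0 pᵉ≉0)

  characteristic : ∀ {p e} → q ≡ p ℕ.^ e → p · 1# ≈ 0#
  characteristic {p} {e} q≡pᵉ = ^·1≈0 p e (≡.subst (λ k → k · 1# ≈ 0#) q≡pᵉ q·1≈0)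

  multiple≈0 : ∀ j {k} → k · 1# ≈ 0# → (j ℕ.* k) · 1# ≈ 0#
  multiple≈0 j k≈0 = trans (×1-homo-* j _) (trans (*-congˡ k≈0) (zeroʳ _))

  consecutive : ∀ {i j} → 1 ℕ.+ i ≡ j → i · 1# ≈ 0# → ¬ (j · 1# ≈ 0#)
  consecutive ≡.refl i≈0 j≈0 = nontrivial (trans (sym (trans (+-congˡ i≈0) (+-identityʳ 1#))) j≈0)

  difference : ∀ {i j} → i < j → i · 1# ≈ j · 1# → (j ∸ i) · 1# ≈ 0#
  difference {i} {j} i<j same = +-cancelˡ (i · 1#) _ _ (begin
    i · 1# + (j ∸ i) · 1#    ≈⟨ ×-homo-+ 1# i (j ∸ i) ⟨
    (i ℕ.+ (j ∸ i)) · 1#     ≡⟨ ≡.cong (_· 1#) (ℕ.m+[n∸m]≡n (ℕ.<⇒≤ i<j)) ⟩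
    j · 1#                   ≈⟨ same ⟨
    i · 1#                   ≈⟨ +-identityʳ _ ⟨
    i · 1# + 0#              ∎)

  module _ (q-prime : Prime q) where

    -- By a Bézout identity between k and q, both vanishing in the field would give 1 = 0.
    below-characteristic : ∀ {k} → 0 < k → k < q → ¬ (k · 1# ≈ 0#)
    below-characteristic {k} 0<k k<q k≈0 with coprime-Bézout (prime⇒coprime q-prime {{>-nonZero 0<k}} k<q)
    ... | Bézout.Identity.+- x y 1+yk≡xq = consecutive 1+yk≡xq (multiple≈0 y k≈0) (multiple≈0 x q·1≈0)
    ... | Bézout.Identity.-+ x y 1+xq≡yk = consecutive 1+xq≡yk (multiple≈0 x q·1≈0) (multiple≈0 y k≈0)

    ·1-injective : ∀ {i j} → i < q → j < q → i · 1# ≈ j · 1# → i ≡ j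
    ·1-injective {i} {j} i<q j<q same with ℕ.<-cmp i j
    ... | tri< i<j _ _ = contradiction (difference i<j same) (below-characteristic (ℕ.m<n⇒0<n∸m i<j) (ℕ.≤-<-trans (ℕ.m∸n≤m j i) j<q))
    ... | tri≈ _ i≡j _ = i≡j
    ... | tri> _ _ j<i = contradiction (difference j<i (sym same)) (below-characteristic (ℕ.m<n⇒0<n∸m j<i) (ℕ.≤-<-trans (ℕ.m∸n≤m i j) i<q))

    prime-field : ∀ x → ∃[ i ] x ≈ toℕ {q} i · 1#
    prime-field x with i , toi≡tox ← injective⇒surjective {f = λ i → E.to (toℕ i · 1#)}
      (λ {i} {j} same → Fin.toℕ-injective (·1-injective (Fin.toℕ<n i) (Fin.toℕ<n j) (E-injective same))) (E.to x) =
      i , sym (E-injective toi≡tox)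

-- The algebra generated by a matrix

module PolynomialAction {q c ℓ₁ ℓ₂} (F : FiniteField q c ℓ₁ ℓ₂) {m : ℕ} (A : Geometry.Matrix F m) where

  open FiniteField F hiding (zero)
  open Geometry F using (_*ⱽ_; *ⱽ-cong; *ⱽ-scale)
  open Algebra.Properties.Semiring.Sum (CommutativeRing.semiring commutativeRing)
  open Algebra.Properties.Ring (CommutativeRing.ring commutativeRing) using (-1*x≈-x)
  open Algebra.Properties.CommutativeSemigroup (CommutativeRing.+-commutativeSemigroup commutativeRing)
    using () renaming (interchange to +-interchange)
  open VectorEquality setoid using (_≋_)
  open SetoidReasoning setoid

  -- Expressions for the polynomials in A, acting on vectors.  They are not normalised: equality
  -- is imposed afterwards by their action.
  infixl 6 _⊕_
  infixl 7 _⊗_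
  data Polynomial : Set c where
    const   : Carrier → Polynomial
    X       : Polynomial
    _⊕_ _⊗_ : Polynomial → Polynomial → Polynomial

  ⟦_⟧ : Polynomial → Vector Carrier m → Vector Carrier m
  ⟦ const s ⟧ u i = s * u i
  ⟦ X       ⟧ u   = A *ⱽ u
  ⟦ x ⊕ y   ⟧ u i = ⟦ x ⟧ u i + ⟦ y ⟧ u i
  ⟦ x ⊗ y   ⟧ u   = ⟦ x ⟧ (⟦ y ⟧ u)

  ⟦⟧-cong : ∀ x {u w} → u ≋ w → ⟦ x ⟧ u ≋ ⟦ x ⟧ w
  ⟦⟧-cong (const s) u≈w i = *-congˡ (u≈w i)
  ⟦⟧-cong X {u} {w} u≈w   = *ⱽ-cong {A = A} {B = A} {v = u} {w = w} (λ _ _ → refl) u≈w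
  ⟦⟧-cong (x ⊕ y)   u≈w i = +-cong (⟦⟧-cong x u≈w i) (⟦⟧-cong y u≈w i)
  ⟦⟧-cong (x ⊗ y)   u≈w   = ⟦⟧-cong x (⟦⟧-cong y u≈w)

  ⟦⟧-scale : ∀ x s u i → ⟦ x ⟧ (λ j → s * u j) i ≈ s * ⟦ x ⟧ u i
  ⟦⟧-scale (const t) s u i = trans (sym (*-assoc t s (u i))) (trans (*-congʳ (*-comm t s)) (*-assoc s t (u i)))
  ⟦⟧-scale X         s u i = *ⱽ-scale A s (λ _ → refl) i
  ⟦⟧-scale (x ⊕ y)   s u i = trans (+-cong (⟦⟧-scale x s u i) (⟦⟧-scale y s u i)) (sym (distribˡ s _ _))
  ⟦⟧-scale (x ⊗ y)   s u i = trans (⟦⟧-cong x (⟦⟧-scale y s u) i) (⟦⟧-scale x s (⟦ y ⟧ u) i)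

  ⟦⟧-+ : ∀ x u w i → ⟦ x ⟧ (λ j → u j + w j) i ≈ ⟦ x ⟧ u i + ⟦ x ⟧ w i
  ⟦⟧-+ (const s) u w i = distribˡ s (u i) (w i)
  ⟦⟧-+ X         u w i = trans (sum-cong-≋ (λ j → distribˡ (A i j) (u j) (w j))) (∑-distrib-+ (λ j → A i j * u j) (λ j → A i j * w j))
  ⟦⟧-+ (x ⊕ y)   u w i = trans (+-cong (⟦⟧-+ x u w i) (⟦⟧-+ y u w i)) (+-interchange _ _ _ _)
  ⟦⟧-+ (x ⊗ y)   u w i = trans (⟦⟧-cong x (⟦⟧-+ y u w) i) (⟦⟧-+ x (⟦ y ⟧ u) (⟦ y ⟧ w) i)

  X-comm : ∀ x u i → ⟦ x ⟧ (A *ⱽ u) i ≈ (A *ⱽ ⟦ x ⟧ u) i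
  X-comm (const s) u i = sym (⟦⟧-scale X s u i)
  X-comm X         u i = refl
  X-comm (x ⊕ y)   u i = trans (+-cong (X-comm x u i) (X-comm y u i)) (sym (⟦⟧-+ X (⟦ x ⟧ u) (⟦ y ⟧ u) i))
  X-comm (x ⊗ y)   u i = trans (⟦⟧-cong x (X-comm y u) i) (X-comm x (⟦ y ⟧ u) i)

  -- Any two polynomials in A commute.
  ⟦⟧-comm : ∀ x y u i → ⟦ x ⟧ (⟦ y ⟧ u) i ≈ ⟦ y ⟧ (⟦ x ⟧ u) i
  ⟦⟧-comm x (const s) u i = ⟦⟧-scale x s u i
  ⟦⟧-comm x X         u i = X-comm x u i
  ⟦⟧-comm x (y ⊕ z)   u i = trans (⟦⟧-+ x (⟦ y ⟧ u) (⟦ z ⟧ u) i) (+-cong (⟦⟧-comm x y u i) (⟦⟧-comm x z u i))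
  ⟦⟧-comm x (y ⊗ z)   u i = trans (⟦⟧-comm x y (⟦ z ⟧ u) i) (⟦⟧-cong y (⟦⟧-comm x z u) i)

  module _ (v : Vector Carrier m) where

    neg : Polynomial → Polynomial
    neg x = const (- 1#) ⊗ x

    neg-value : ∀ x i → ⟦ neg x ⟧ v i ≈ - ⟦ x ⟧ v i
    neg-value x i = -1*x≈-x _

    -- Polynomials are identified when they agree on the one vector v.  Multiplication respects
    -- this by commutativity, without v being assumed cyclic.
    infix 4 _≐_
    _≐_ : Polynomial → Polynomial → Set ℓ₁
    x ≐ y = ⟦ x ⟧ v ≋ ⟦ y ⟧ v

    ⊗-cong : ∀ {x x′ y y′} → x ≐ x′ → y ≐ y′ → x ⊗ y ≐ x′ ⊗ y′
    ⊗-cong {x} {x′} {y} {y′} x≐x′ y≐y′ i = begin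
      ⟦ x ⟧ (⟦ y ⟧ v) i     ≈⟨ ⟦⟧-cong x y≐y′ i ⟩
      ⟦ x ⟧ (⟦ y′ ⟧ v) i    ≈⟨ ⟦⟧-comm x y′ v i ⟩
      ⟦ y′ ⟧ (⟦ x ⟧ v) i    ≈⟨ ⟦⟧-cong y′ x≐x′ i ⟩
      ⟦ y′ ⟧ (⟦ x′ ⟧ v) i   ≈⟨ ⟦⟧-comm y′ x′ v i ⟩
      ⟦ x′ ⟧ (⟦ y′ ⟧ v) i   ∎

    polynomial-isCommutativeRing : IsCommutativeRing _≐_ _⊕_ _⊗_ neg (const 0#) (const 1#)
    polynomial-isCommutativeRing = record
      { isRing = record
        { +-isAbelianGroup = record
          { isGroup = record
            { isMonoid = record
              { isSemigroup = record
                { isMagma = record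
                  { isEquivalence = record
                    { refl  = λ i → refl
                    ; sym   = λ x≐y i → sym (x≐y i)
                    ; trans = λ x≐y y≐z i → trans (x≐y i) (y≐z i)
                    }
                  ; ∙-cong = λ x≐x′ y≐y′ i → +-cong (x≐x′ i) (y≐y′ i)
                  }
                ; assoc = λ x y z i → +-assoc _ _ _
                }
              ; identity = (λ x i → trans (+-congʳ (zeroˡ _)) (+-identityˡ _))
                         , (λ x i → trans (+-congˡ (zeroˡ _)) (+-identityʳ _))
              }
            ; inverse = (λ x i → trans (+-congʳ (neg-value x i)) (trans (-‿inverseˡ _) (sym (zeroˡ _))))
                      , (λ x i → trans (+-congˡ (neg-value x i)) (trans (-‿inverseʳ _) (sym (zeroˡ _))))
            ; ⁻¹-cong = λ x≐y i → *-congˡ (x≐y i)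
            }
          ; comm = λ x y i → +-comm _ _
          }
        ; *-cong     = λ {x} {x′} {y} {y′} → ⊗-cong {x} {x′} {y} {y′}
        ; *-assoc    = λ x y z i → refl
        ; *-identity = (λ x i → *-identityˡ _) , (λ x → ⟦⟧-cong x λ i → *-identityˡ _)
        ; distrib    = (λ x y z i → ⟦⟧-+ x (⟦ y ⟧ v) (⟦ z ⟧ v) i) , (λ x y z i → refl)
        }
      ; *-comm = λ x y i → ⟦⟧-comm x y v i
      }

    -- F[A] modulo the annihilator of v; x ↦ x v embeds it in the space of vectors.
    polynomialRing : CommutativeRing c ℓ₁
    polynomialRing = record { isCommutativeRing = polynomial-isCommutativeRing }

-- Orbits inside the hyperplane at infinity

funToFin-cong : ∀ {m n} {f g : Fin m → Fin n} → (∀ i → f i ≡ g i) → Fin.funToFin f ≡ Fin.funToFin g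
funToFin-cong {zero}  f≗g = ≡.refl
funToFin-cong {suc m} f≗g = ≡.cong₂ Fin.combine (f≗g zero) (funToFin-cong (f≗g ∘ suc))

finToFun-injective : ∀ {m n} {i j : Fin (m ℕ.^ n)} → (∀ k → Fin.finToFun {m} {n} i k ≡ Fin.finToFun j k) → i ≡ j
finToFun-injective {m} {n} {i} {j} same = ≡.trans (≡.sym (Fin.funToFin-finToFin {n} {m} i))
  (≡.trans (funToFin-cong same) (Fin.funToFin-finToFin {n} {m} j))

module _ {q c ℓ₁ ℓ₂} (F : FiniteField q c ℓ₁ ℓ₂) {n : ℕ} (Ψ : Geometry.Automorphism F n) where

  open FiniteField F hiding (zero)
  open Geometry F hiding (module E)
  open PolynomialAction F (proj₁ Ψ)
  open VectorEquality setoid using (_≋_)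
  open SetoidReasoning setoid
  open Orbits (ℙ n) (action Ψ)
  open Dynamics (ℙ n) using (_^_)
  private
    A = proj₁ Ψ
    module E = Inverse enumeration

  -- The origin of the affine space; v is its vector, the last standard basis vector.
  origin : ∃ (U {n})
  origin = point {n} (λ _ → 0#)

  v : Vector Carrier (suc n)
  v = proj₁ (proj₁ origin)

  private
    R = polynomialRing v
    module R = CommutativeRing R
    open Algebra.Properties.Semiring.Mult (CommutativeRing.semiring commutativeRing) using () renaming (_×_ to infixr 8 _·_)
    module Mult = Algebra.Properties.Semiring.Mult R.semiring
    module Exp = Algebra.Properties.CommutativeSemiring.Exp R.commutativeSemiring

  last : Vector Carrier (suc n) → Carrier
  last u = u (Fin.fromℕ n)

  iterate-vector : ∀ k P → proj₁ ((action Ψ ^ (+ k)) P) ≋ ⟦ X Exp.^ k ⟧ (proj₁ P)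
  iterate-vector zero    P i = sym (*-identityˡ _)
  iterate-vector (suc k) P   = ⟦⟧-cong X (iterate-vector k P)

  -- The A-orbit of u stays in the hyperplane.  Together these vectors form the largest A-invariant
  -- subspace of the hyperplane.
  OrbitInH : Vector Carrier (suc n) → Set ℓ₁
  OrbitInH u = ∀ k → last (⟦ X Exp.^ k ⟧ u) ≈ 0#

  OrbitInH-resp : ∀ {u w} → u ≋ w → OrbitInH u → OrbitInH w
  OrbitInH-resp u≈w u-orbitInH k = trans (⟦⟧-cong (X Exp.^ k) (λ i → sym (u≈w i)) (Fin.fromℕ n)) (u-orbitInH k)

  OrbitInH-+ : ∀ {u w} → OrbitInH u → OrbitInH w → OrbitInH (λ i → u i + w i)
  OrbitInH-+ u-orbitInH w-orbitInH k =
    trans (⟦⟧-+ (X Exp.^ k) _ _ (Fin.fromℕ n)) (trans (+-cong (u-orbitInH k) (w-orbitInH k)) (+-identityˡ 0#))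

  OrbitInH-⟦⟧ : ∀ x {u} → OrbitInH u → OrbitInH (⟦ x ⟧ u)
  OrbitInH-⟦⟧ (const s) {u} u-orbitInH k = trans (⟦⟧-scale (X Exp.^ k) s u (Fin.fromℕ n)) (trans (*-congˡ (u-orbitInH k)) (zeroʳ s))
  OrbitInH-⟦⟧ X         {u} u-orbitInH k = trans (⟦⟧-comm (X Exp.^ k) X u (Fin.fromℕ n)) (u-orbitInH (suc k))
  OrbitInH-⟦⟧ (x ⊕ y)       u-orbitInH   = OrbitInH-+ (OrbitInH-⟦⟧ x u-orbitInH) (OrbitInH-⟦⟧ y u-orbitInH)
  OrbitInH-⟦⟧ (x ⊗ y)       u-orbitInH   = OrbitInH-⟦⟧ x (OrbitInH-⟦⟧ y u-orbitInH)

  v-last : last v ≈ 1#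
  v-last = affine-last {n} (λ _ → 0#)

  -- u = s Aᵏ v for a nonzero scalar s.
  Monomial : Vector Carrier (suc n) → Set (c ⊔ ℓ₁)
  Monomial u = ∃[ s ] ∃[ k ] ¬ (s ≈ 0#) × u ≋ ⟦ const s ⊗ X Exp.^ k ⟧ v

  orbit⇒monomial : ∀ P → proj₁ origin ⟶ P → Monomial (proj₁ P)
  orbit⇒monomial P (k , s , s≉0 , u≈) = s , k , s≉0 , λ i → trans (u≈ i) (*-congˡ (iterate-vector k (proj₁ origin) i))

  avoids⇒orbitInH : ∀ P → (∀ k → ¬ U ((action Ψ ^ (+ k)) P)) → OrbitInH (proj₁ P)
  avoids⇒orbitInH P never k = decidable-stable (_ ≈? 0#) λ last≉0 →
    never k λ last≈0 → last≉0 (trans (sym (iterate-vector k P (Fin.fromℕ n))) last≈0)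

  module _ (U-transitive : ∀ (P Q : ∃ (U {n})) → proj₁ P ⟶ proj₁ Q) where

    U⇒monomial : ∀ u → ¬ (last u ≈ 0#) → Monomial u
    U⇒monomial u last≉0 = orbit⇒monomial (proj₁ P) (U-transitive origin P)
      where
      P : ∃ (U {n})
      P = (u , λ u≈0 → last≉0 (u≈0 (Fin.fromℕ n))) , last≉0

    -- If the orbit of P meets U then P lies on the orbit of the origin, because orbits are
    -- symmetric.
    nonzero⇒orbitInH⊎monomial : ∀ (P : NonzeroVector (suc n)) → OrbitInH (proj₁ P) ⊎ Monomial (proj₁ P)
    nonzero⇒orbitInH⊎monomial P = [ enters , avoids ]′ (meets? (recurrent (action Ψ)) {U = U} (λ {P} {Q} → U-resp {n} {P} {Q}) U? P)
      where
      enters : ∃[ k ] U ((action Ψ ^ (+ k)) P) → OrbitInH (proj₁ P) ⊎ Monomial (proj₁ P)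
      enters (k , Q∈U) = inj₂ (orbit⇒monomial P (⟶-trans {proj₁ origin} {Q} {P} (U-transitive origin (Q , Q∈U))
        (⟶-sym (recurrent (action Ψ)) {P} {Q} (k , Setoid.refl (ℙ n) {Q}))))
        where Q = (action Ψ ^ (+ k)) P
      avoids : (∀ k → ¬ U ((action Ψ ^ (+ k)) P)) → OrbitInH (proj₁ P) ⊎ Monomial (proj₁ P)
      avoids never = inj₁ (avoids⇒orbitInH P never)

    orbitInH⊎monomial : ∀ u → OrbitInH u ⊎ Monomial u
    orbitInH⊎monomial u with Fin.all? (λ i → u i ≈? 0#)
    ... | no u≉0  = nonzero⇒orbitInH⊎monomial (u , u≉0)
    ... | yes u≈0 = inj₁ (OrbitInH-resp {λ _ → 0# * 0#} (λ i → trans (zeroˡ _) (sym (u≈0 i))) λ k →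
      trans (⟦⟧-scale (X Exp.^ k) 0# (λ _ → 0#) (Fin.fromℕ n)) (zeroˡ _))

    v+u∉H : ∀ {u} → last u ≈ 0# → ¬ (last v + last u ≈ 0#)
    v+u∉H last≈0 v+u≈0 = nontrivial (trans (sym (trans (+-cong v-last last≈0) (+-identityʳ 1#))) v+u≈0)

    -- u = (v + u) - v, and v + u lies outside the hyperplane, hence is s Aᵏ v.  So every vector of
    -- the hyperplane is x v for some x in F[A].
    hyperplane⇒polynomial : ∀ u → last u ≈ 0# → ∃[ x ] ⟦ x ⟧ v ≋ u
    hyperplane⇒polynomial u last≈0 with s , k , _ , v+u≈ ← U⇒monomial (λ i → v i + u i) (v+u∉H {u} last≈0) =
      const s ⊗ X Exp.^ k ⊕ const (- 1#) , λ i → begin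
      ⟦ const s ⊗ X Exp.^ k ⟧ v i + - 1# * v i    ≈⟨ +-cong (sym (v+u≈ i)) (Algebra.Properties.Ring.-1*x≈-x (CommutativeRing.ring commutativeRing) (v i)) ⟩
      v i + u i - v i                             ≈⟨ +-congʳ (+-comm (v i) (u i)) ⟩
      u i + v i - v i                             ≈⟨ +-assoc _ _ _ ⟩
      u i + (v i - v i)                           ≈⟨ +-congˡ (-‿inverseʳ (v i)) ⟩
      u i + 0#                                    ≈⟨ +-identityʳ _ ⟩
      u i                                         ∎

    -- The annihilator of v being factored out, elements of the ring are judged by their value at v.
    cyclicUnits : CyclicUnits F R ℓ₁
    cyclicUnits = record
      { ι        = const
      ; ι-cong   = λ s≈t i → *-congʳ s≈t
      ; ι-+      = λ s t i → distribʳ (v i) s t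
      ; ι-*      = λ s t i → *-assoc s t (v i)
      ; ι-1      = λ i → refl
      ; size     = q ℕ.^ suc n
      ; code     = λ x → Fin.funToFin (E.to ∘ ⟦ x ⟧ v)
      ; code-injective = λ {x} {y} same i → E-injective
          (≡.trans (≡.sym (Fin.finToFun-funToFin (E.to ∘ ⟦ x ⟧ v) i))
          (≡.trans (≡.cong (λ k → Fin.finToFun {q} {suc n} k i) same) (Fin.finToFun-funToFin (E.to ∘ ⟦ y ⟧ v) i)))
      ; _≈?_     = λ x y → Fin.all? λ i → ⟦ x ⟧ v i ≈? ⟦ y ⟧ v i
      ; H        = λ x → last (⟦ x ⟧ v) ≈ 0#
      ; H-resp   = λ x≐y x∈H → trans (sym (x≐y (Fin.fromℕ n))) x∈H
      ; H-+      = λ x∈H y∈H → trans (+-cong x∈H y∈H) (+-identityˡ 0#)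
      ; H-ι      = λ {s} sv≈0 → trans (sym (trans (*-congˡ v-last) (*-identityʳ s))) sv≈0
      ; W        = λ x → OrbitInH (⟦ x ⟧ v)
      ; W-resp   = λ {x} {y} → OrbitInH-resp {⟦ x ⟧ v} {⟦ y ⟧ v}
      ; W-+      = λ {x} {y} → OrbitInH-+ {⟦ x ⟧ v} {⟦ y ⟧ v}
      ; W-*      = λ x {y} → OrbitInH-⟦⟧ x {⟦ y ⟧ v}
      ; W⊆H      = λ {x} x∈W → trans (sym (*-identityˡ (last (⟦ x ⟧ v)))) (x∈W 0)
      ; a        = X
      ; period   = period
      ; split    = split
      }
      where
      period : ∃[ t ] 1 ≤ t × ∃[ s ] ¬ (s ≈ 0#) × X Exp.^ t R.≈ const s
      period = fromReturn (recurrent (action Ψ) (proj₁ origin))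
        where
        fromReturn : ∃[ t ] 1 ≤ t × Setoid._≈_ (ℙ n) ((action Ψ ^ (+ t)) (proj₁ origin)) (proj₁ origin) → _
        fromReturn (t , 1≤t , s , s≉0 , Aᵗv≈sv) =
          t , 1≤t , s , s≉0 , λ i → trans (sym (iterate-vector t (proj₁ origin) i)) (Aᵗv≈sv i)
      split : ∀ x → OrbitInH (⟦ x ⟧ v) ⊎ ∃[ s ] ∃[ k ] (∃[ t ] ¬ (t ≈ 0#) × s R.≈ const t) × x R.≈ s R.* X Exp.^ k
      split x with orbitInH⊎monomial (⟦ x ⟧ v)
      ... | inj₁ orbitInH              = inj₁ orbitInH
      ... | inj₂ (s , k , s≉0 , x≈) = inj₂ (const s , k , (s , s≉0 , λ i → refl) , x≈)

    ·1-value : ∀ k i → ⟦ k Mult.× R.1# ⟧ v i ≈ (k · 1#) * v i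
    ·1-value zero    i = refl
    ·1-value (suc k) i = trans (+-congˡ (·1-value k i)) (sym (distribʳ (v i) 1# (k · 1#)))

    -- The qⁿ vectors of the hyperplane, indexed by the base q digits of i.
    hyperplaneVector : Fin (q ℕ.^ n) → Vector Carrier (suc n)
    hyperplaneVector i = insertAt (E.from ∘ Fin.finToFun i) (Fin.fromℕ n) 0#

    hyperplaneVector-last : ∀ i → last (hyperplaneVector i) ≈ 0#
    hyperplaneVector-last i = reflexive (Vector.insertAt-lookup (E.from ∘ Fin.finToFun i) (Fin.fromℕ n) 0#)

    hyperplaneVector-injective : ∀ {i j} → hyperplaneVector i ≋ hyperplaneVector j → i ≡ j
    hyperplaneVector-injective {i} {j} same = finToFun-injective {q} {n} λ k →
      ≡.trans (≡.sym (E.strictlyInverseˡ _)) (≡.trans (E.to-cong (begin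
        E.from (Fin.finToFun i k)                             ≡⟨ Vector.insertAt-punchIn (E.from ∘ Fin.finToFun i) (Fin.fromℕ n) 0# k ⟨
        hyperplaneVector i (Fin.punchIn (Fin.fromℕ n) k)      ≈⟨ same _ ⟩
        hyperplaneVector j (Fin.punchIn (Fin.fromℕ n) k)      ≡⟨ Vector.insertAt-punchIn (E.from ∘ Fin.finToFun j) (Fin.fromℕ n) 0# k ⟩
        E.from (Fin.finToFun j k)                             ∎)) (E.strictlyInverseˡ _))

    orbitInH-bound : ∀ {p} → Prime p → p ≤ q → p · 1# ≈ 0# → ∀ {u} → OrbitInH u → ¬ (u ≋ λ _ → 0#) →
                   q ≤ p × (q ℕ.^ n ≤ p ⊎ (p ≡ 2 × q ℕ.^ n ≤ 4))
    orbitInH-bound {p} p-prime p≤q char {u} u-orbitInH u≉0 =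
      CyclicUnitsStructure.nonzero-W-bounds F R cyclicUnits p-prime p≤q
        (λ i → trans (·1-value p i) (*-congʳ char))
        {w} (OrbitInH-resp {u} {⟦ w ⟧ v} (λ i → sym (w≈u i)) u-orbitInH)
        (λ w≈0 → u≉0 λ i → trans (sym (w≈u i)) (trans (w≈0 i) (zeroˡ _)))
        f (λ {i} {j} fi≈fj → hyperplaneVector-injective λ k → trans (sym (f-value i k)) (trans (fi≈fj k) (f-value j k)))
        (λ i → trans (f-value i (Fin.fromℕ n)) (hyperplaneVector-last i))
      where
      w = proj₁ (hyperplane⇒polynomial u (trans (sym (*-identityˡ _)) (u-orbitInH 0)))
      w≈u : ⟦ w ⟧ v ≋ u
      w≈u = proj₂ (hyperplane⇒polynomial u (trans (sym (*-identityˡ _)) (u-orbitInH 0)))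
      f : Fin (q ℕ.^ n) → Polynomial
      f i = proj₁ (hyperplane⇒polynomial (hyperplaneVector i) (hyperplaneVector-last i))
      f-value : ∀ i → ⟦ f i ⟧ v ≋ hyperplaneVector i
      f-value i = proj₂ (hyperplane⇒polynomial (hyperplaneVector i) (hyperplaneVector-last i))

    -- The bounds hold as soon as some orbit avoids U.
    avoiding-bound : ∀ {p} → Prime p → p ≤ q → p · 1# ≈ 0# → ∀ P → (∀ k → ¬ U ((action Ψ ^ (+ k)) P)) →
                     q ≤ p × (q ℕ.^ n ≤ p ⊎ (p ≡ 2 × q ℕ.^ n ≤ 4))
    avoiding-bound p-prime p≤q char P avoids = orbitInH-bound p-prime p≤q char (avoids⇒orbitInH P avoids) (proj₂ P)

-- Transitivity of an automorphism and of its jump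

m^-cancel-≤ : ∀ m {j k} → 1 < m → m ℕ.^ j ≤ m ℕ.^ k → j ≤ k
m^-cancel-≤ m 1<m mʲ≤mᵏ = ℕ.≮⇒≥ λ k<j → ℕ.<⇒≱ (ℕ.^-monoʳ-< m 1<m k<j) mʲ≤mᵏ

exceptional-cases : ∀ {q p n} → Prime p → p ≤ q → 1 ≤ n → q ≤ p × (q ℕ.^ n ≤ p ⊎ (p ≡ 2 × q ℕ.^ n ≤ 4)) →
              (Prime q × n ≡ 1) ⊎ (q ≡ 2 × n ≡ 2)
exceptional-cases {q} {p} {n} p-prime p≤q 1≤n (q≤p , bound) with ≡.refl ← ℕ.≤-antisym q≤p p≤q | bound
... | inj₁ qⁿ≤q = inj₁ (p-prime , ℕ.≤-antisym
  (m^-cancel-≤ q (ℕ.nonTrivial⇒n>1 q {{prime⇒nonTrivial p-prime}}) (≡.subst (q ℕ.^ n ≤_) (≡.sym (ℕ.^-identityʳ q)) qⁿ≤q)) 1≤n)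
... | inj₂ (≡.refl , 2ⁿ≤4) with ℕ.m≤n⇒m<n∨m≡n (m^-cancel-≤ 2 {n} {2} (s≤s (s≤s z≤n)) 2ⁿ≤4)
...   | inj₁ n<2   = inj₁ (p-prime , ℕ.≤-antisym (ℕ.s≤s⁻¹ n<2) 1≤n)
...   | inj₂ n≡2   = inj₂ (≡.refl , n≡2)

module _ {q c ℓ₁ ℓ₂} (F : FiniteField q c ℓ₁ ℓ₂) {n : ℕ} (Ψ : Geometry.Automorphism F n) where

  open FiniteField F using (0#)
  open Geometry F
  open Orbits (ℙ n) (action Ψ)
  open Dynamics (ℙ n) using (_^_)

  transitive⇒jump-transitive : Transitive (ℙ n) (action Ψ) → Transitive (𝔸 n) (fractionalJump Ψ)
  transitive⇒jump-transitive Ψ-transitive = Equivalence.from (Jump.jump-transitive⇔ F Ψ) λ P Q →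
    transitive⇒⟶ (recurrent (action Ψ)) Ψ-transitive (proj₁ P) (proj₁ Q)

  -- Every orbit enters U, and there is only one orbit through U.
  meeting⇒transitive : (∀ (P Q : ∃ (U {n})) → proj₁ P ⟶ proj₁ Q) →
                       (∀ P → ¬ (∀ k → ¬ U ((action Ψ ^ (+ k)) P))) → Transitive (ℙ n) (action Ψ)
  meeting⇒transitive U-transitive meets P Q = Product.map +_ id
    (connect (enter P) (enter Q))
    where
    enter : ∀ P → ∃[ k ] U ((action Ψ ^ (+ k)) P)
    enter P = [ id , (λ never → contradiction never (meets P)) ]′
      (meets? (recurrent (action Ψ)) {U = U} (λ {P} {Q} → U-resp {n} {P} {Q}) U? P)
    connect : ∃[ j ] U ((action Ψ ^ (+ j)) P) → ∃[ k ] U ((action Ψ ^ (+ k)) Q) → P ⟶ Q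
    connect (j , P′∈U) (k , Q′∈U) = ⟶-trans {P} {P′} {Q} (j , Setoid.refl (ℙ n) {P′})
      (⟶-trans {P′} {Q′} {Q} (U-transitive (P′ , P′∈U) (Q′ , Q′∈U))
        (⟶-sym (recurrent (action Ψ)) {Q} {Q′} (k , Setoid.refl (ℙ n) {Q′})))
      where
      P′ = (action Ψ ^ (+ j)) P
      Q′ = (action Ψ ^ (+ k)) Q

  jump-transitive⇒transitive : IsPrimePower q → 1 ≤ n → ¬ (Prime q × n ≡ 1) → ¬ (q ≡ 2 × n ≡ 2) →
    Transitive (𝔸 n) (fractionalJump Ψ) → Transitive (ℙ n) (action Ψ)
  jump-transitive⇒transitive (p , e , p-prime , 1≤e , q≡pᵉ) 1≤n ¬case₁ ¬case₂ ψ-transitive =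
    meeting⇒transitive U-transitive λ P avoids →
      [ ¬case₁ , ¬case₂ ]′ (exceptional-cases p-prime p≤q 1≤n
        (avoiding-bound F Ψ U-transitive p-prime p≤q (Characteristic.characteristic F {p} {e} q≡pᵉ) P avoids))
    where
    U-transitive : ∀ (P Q : ∃ (U {n})) → proj₁ P ⟶ proj₁ Q
    U-transitive = Equivalence.to (Jump.jump-transitive⇔ F Ψ) ψ-transitive
    p≤q : p ≤ q
    p≤q = ≡.subst₂ _≤_ (ℕ.^-identityʳ p) (≡.sym q≡pᵉ) (ℕ.^-monoʳ-≤ p {{prime⇒nonZero p-prime}} 1≤e)

  -- If the orbit of the origin contains U, then ψ is transitive; a fixed point of Ψ outside U is
  -- not on that orbit.
  fixedPoint⇒counterexample :
    (P : NonzeroVector (suc n)) → ¬ U P → proj₁ P ∼ proj₁ Ψ *ⱽ proj₁ P →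
    (∀ x → proj₁ (point {n} (λ _ → 0#)) ⟶ proj₁ (point x)) →
    Transitive (𝔸 n) (fractionalJump Ψ) × ¬ Transitive (ℙ n) (action Ψ)
  fixedPoint⇒counterexample P P∉U fixed fromOrigin =
    Equivalence.from (Jump.jump-transitive⇔ F Ψ) (λ Q Q′ →
      ⟶-trans {proj₁ Q} {proj₁ O} {proj₁ Q′} (⟶-sym (recurrent (action Ψ)) {proj₁ O} {proj₁ Q} (reach Q)) (reach Q′)) ,
    λ Ψ-transitive → leaves (transitive⇒⟶ (recurrent (action Ψ)) Ψ-transitive P (proj₁ O))
    where
    O : ∃ (U {n})
    O = point (λ _ → 0#)
    reach : ∀ Q → proj₁ O ⟶ proj₁ Q
    reach Q = ⟶-trans {proj₁ O} {proj₁ (point (dehomogenise Q))} {proj₁ Q} (fromOrigin (dehomogenise Q))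
      (⟶-reflexive {proj₁ (point (dehomogenise Q))} {proj₁ Q}
        (Setoid.sym (ℙ n) {proj₁ (point (dehomogenise Q))} {proj₁ Q} (point-dehomogenise Q)))
    stays : ∀ k → proj₁ P ∼ proj₁ ((action Ψ ^ (+ k)) P)
    stays zero    = Setoid.refl (ℙ n) {P}
    stays (suc k) = ∼-trans fixed (apply-cong (proj₁ Ψ) (stays k))
    leaves : ¬ (P ⟶ proj₁ O)
    leaves (k , O≈) = P∉U (U-resp {n} {proj₁ O} {P} (∼-trans O≈ (∼-sym (stays k))) (proj₂ O))

-- Counterexamples from Jordan blocks

k+0+1≡suc-k : ∀ k → k ℕ.+ 0 ℕ.+ 1 ≡ suc k
k+0+1≡suc-k k = ≡.trans (ℕ.+-comm (k ℕ.+ 0) 1) (≡.cong suc (ℕ.+-identityʳ k))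

-- Matrices and vectors with natural entries, and their images in F under k ↦ k · 1.  Products
-- are computed over ℕ and reduced afterwards.
module NaturalMatrices {q c ℓ₁ ℓ₂} (F : FiniteField q c ℓ₁ ℓ₂) where

  open FiniteField F hiding (zero)
  open Geometry F
  open Algebra.Properties.Semiring.Sum (CommutativeRing.semiring commutativeRing) using (sum)
  open Algebra.Properties.Semiring.Mult (CommutativeRing.semiring commutativeRing)
    using (×1-homo-*; ×-homo-+) renaming (_×_ to infixr 8 _·_)
  open Algebra.Properties.Semiring.Sum ℕ.+-*-semiring using () renaming (sum to sumℕ)
  open VectorEquality setoid using (_≋_)

  Matrixℕ : ℕ → Set
  Matrixℕ m = Fin m → Fin m → ℕ

  infixl 7 _⊛_ _⊛ⱽ_
  _⊛_ : ∀ {m} → Matrixℕ m → Matrixℕ m → Matrixℕ m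
  (M ⊛ N) i k = sumℕ (λ j → M i j ℕ.* N j k)

  _⊛ⱽ_ : ∀ {m} → Matrixℕ m → (Fin m → ℕ) → Fin m → ℕ
  (M ⊛ⱽ u) i = sumℕ (λ j → M i j ℕ.* u j)

  reduceᴹ : ∀ {m} → Matrixℕ m → Matrix m
  reduceᴹ M i j = M i j · 1#

  reduceⱽ : ∀ {m} → (Fin m → ℕ) → Vector Carrier m
  reduceⱽ u i = u i · 1#

  sum-reduce : ∀ {m} (f g : Fin m → ℕ) → sum (λ j → f j · 1# * g j · 1#) ≈ sumℕ (λ j → f j ℕ.* g j) · 1#
  sum-reduce {zero}  f g = refl
  sum-reduce {suc m} f g = trans (+-cong (sym (×1-homo-* (f zero) (g zero))) (sum-reduce (f ∘ suc) (g ∘ suc)))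
    (sym (×-homo-+ 1# (f zero ℕ.* g zero) _))

  *ⱽ-reduce : ∀ {m} (M : Matrixℕ m) u → reduceᴹ M *ⱽ reduceⱽ u ≋ reduceⱽ (M ⊛ⱽ u)
  *ⱽ-reduce M u i = sum-reduce (M i) u

  1·1≈1 : 1 · 1# ≈ 1#
  1·1≈1 = +-identityʳ 1#

  reduce-GL : ∀ {m} (M N : Matrixℕ m) → reduceᴹ (N ⊛ M) ≈ᴹ 1ᴹ → reduceᴹ (M ⊛ N) ≈ᴹ 1ᴹ → GL m
  reduce-GL M N NM≈1 MN≈1 = reduceᴹ M , reduceᴹ N ,
    (λ i k → trans (sum-reduce (N i) (λ j → M j k)) (NM≈1 i k)) ,
    (λ i k → trans (sum-reduce (M i) (λ j → N j k)) (MN≈1 i k))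

  module _ {n : ℕ} (M N : Matrixℕ (suc n))
      (NM≈1 : reduceᴹ (N ⊛ M) ≈ᴹ 1ᴹ) (MN≈1 : reduceᴹ (M ⊛ N) ≈ᴹ 1ᴹ) where

    private
      Ψ : Automorphism n
      Ψ = reduce-GL M N NM≈1 MN≈1
    open Orbits (ℙ n) (action Ψ)
    open Dynamics (ℙ n) using (_^_)

    -- w is a fixed vector in the hyperplane and u k the k-th iterate of the last basis vector; all
    -- affine points must occur among the latter.
    naturalOrbit⇒counterexample :
      (w : Fin (suc n) → ℕ) → w (Fin.fromℕ n) ≡ 0 → ¬ (reduceⱽ w ≋ λ _ → 0#) → (∀ i → (M ⊛ⱽ w) i ≡ w i) →
      (u : ℕ → Fin (suc n) → ℕ) → affine {n} (λ _ → 0#) ≋ reduceⱽ (u 0) → (∀ k i → (M ⊛ⱽ u k) i ≡ u (suc k) i) →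
      (∀ x → ∃[ k ] affine {n} x ≋ reduceⱽ (u k)) →
      Σ[ Ψ ∈ Automorphism n ] (Transitive (𝔸 n) (fractionalJump Ψ) × ¬ Transitive (ℙ n) (action Ψ))
    naturalOrbit⇒counterexample w w-last w≉0 Mw≡w u u₀≈ Mu≡u covers = Ψ ,
      fixedPoint⇒counterexample F Ψ (reduceⱽ w , w≉0) (λ last≉0 → last≉0 (reflexive (≡.cong (_· 1#) w-last)))
        (≈⇒∼ λ i → sym (trans (*ⱽ-reduce M w i) (reflexive (≡.cong (_· 1#) (Mw≡w i)))))
        reach
      where
      O : NonzeroVector (suc n)
      O = proj₁ (point {n} (λ _ → 0#))
      orbit : ∀ k → proj₁ ((action Ψ ^ (+ k)) O) ≋ reduceⱽ (u k)
      orbit zero      = u₀≈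
      orbit (suc k) i = trans (*ⱽ-cong {A = reduceᴹ M} {B = reduceᴹ M} {v = proj₁ ((action Ψ ^ (+ k)) O)} {w = reduceⱽ (u k)}
          (λ _ _ → refl) (orbit k) i)
        (trans (*ⱽ-reduce M (u k) i) (reflexive (≡.cong (_· 1#) (Mu≡u k i))))
      reach : ∀ x → O ⟶ proj₁ (point x)
      reach x = proj₁ (covers x) , ≈⇒∼ λ i → trans (proj₂ (covers x) i) (sym (orbit (proj₁ (covers x)) i))

  -- The matrix with rows (1 1) and (0 1), which acts on the affine line as x ↦ x + 1.
  jordan₂ : Matrixℕ 2
  jordan₂ 1F 0F = 0
  jordan₂ _  _  = 1

  module _ (q-prime : Prime q) where

    private
      instance
        q-nonZero : NonZero q
        q-nonZero = prime⇒nonZero q-prime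

    -- The entry -1 of the inverse is represented by q - 1.
    jordan₂⁻¹ : Matrixℕ 2
    jordan₂⁻¹ 0F 1F = ℕ.pred q
    jordan₂⁻¹ 1F 0F = 0
    jordan₂⁻¹ _  _  = 1

    prime-counterexample : Σ[ Ψ ∈ Automorphism 1 ] (Transitive (𝔸 1) (fractionalJump Ψ) × ¬ Transitive (ℙ 1) (action Ψ))
    prime-counterexample = naturalOrbit⇒counterexample jordan₂ jordan₂⁻¹ leftInverse rightInverse
      (λ { 0F → 1 ; 1F → 0 }) ≡.refl (λ 1≈0 → nontrivial (trans (sym 1·1≈1) (1≈0 0F))) (λ { 0F → ≡.refl ; 1F → ≡.refl })
      u (λ { 0F → refl ; 1F → sym 1·1≈1 })
      (λ { k 0F → k+0+1≡suc-k k ; k 1F → ≡.refl })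
      covers
      where
      u : ℕ → Fin 2 → ℕ
      u k 0F = k
      u k 1F = 1
      ≡q⇒≈0 : ∀ {k} → k ≡ q → k · 1# ≈ 0#
      ≡q⇒≈0 ≡.refl = Characteristic.q·1≈0 F
      ≡1⇒≈1 : ∀ {k} → k ≡ 1 → k · 1# ≈ 1#
      ≡1⇒≈1 ≡.refl = 1·1≈1
      leftInverse : reduceᴹ (jordan₂⁻¹ ⊛ jordan₂) ≈ᴹ 1ᴹ
      leftInverse 0F 0F = ≡1⇒≈1 (≡.cong suc (≡.trans (ℕ.+-identityʳ _) (ℕ.*-zeroʳ (ℕ.pred q))))
      leftInverse 0F 1F = ≡q⇒≈0 (≡.trans (≡.cong suc (≡.trans (ℕ.+-identityʳ _) (ℕ.*-identityʳ _))) (ℕ.suc-pred q))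
      leftInverse 1F 0F = refl
      leftInverse 1F 1F = 1·1≈1
      rightInverse : reduceᴹ (jordan₂ ⊛ jordan₂⁻¹) ≈ᴹ 1ᴹ
      rightInverse 0F 0F = 1·1≈1
      rightInverse 0F 1F = ≡q⇒≈0 (≡.trans (k+0+1≡suc-k (ℕ.pred q)) (ℕ.suc-pred q))
      rightInverse 1F 0F = refl
      rightInverse 1F 1F = 1·1≈1
      covers : ∀ x → ∃[ k ] affine {1} x ≋ reduceⱽ (u k)
      covers x = let i , x₀≈i = Characteristic.prime-field F q-prime (x 0F) in
        toℕ i , λ { 0F → x₀≈i ; 1F → sym 1·1≈1 }

module _ {c ℓ₁ ℓ₂} (F : FiniteField 2 c ℓ₁ ℓ₂) where

  open FiniteField F hiding (zero)
  open Geometry F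
  open NaturalMatrices F
  open Algebra.Properties.Semiring.Mult (CommutativeRing.semiring commutativeRing) using () renaming (_×_ to infixr 8 _·_)
  open VectorEquality setoid using (_≋_)

  -- The unipotent Jordan block of size 3 and, modulo 2, its inverse, the upper triangular matrix
  -- of ones.  The block has order 4 modulo 2, the number of points of the affine plane.
  jordan₃ jordan₃⁻¹ : Matrixℕ 3
  jordan₃ 0F 2F = 0
  jordan₃ i  j  = jordan₃⁻¹ i j
  jordan₃⁻¹ 1F 0F = 0
  jordan₃⁻¹ 2F 0F = 0
  jordan₃⁻¹ 2F 1F = 0
  jordan₃⁻¹ _  _  = 1

  𝔽₂-counterexample : Σ[ Ψ ∈ Automorphism 2 ] (Transitive (𝔸 2) (fractionalJump Ψ) × ¬ Transitive (ℙ 2) (action Ψ))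
  𝔽₂-counterexample = naturalOrbit⇒counterexample jordan₃ jordan₃⁻¹ leftInverse rightInverse
    (λ { 0F → 1 ; 1F → 0 ; 2F → 0 }) ≡.refl (λ 1≈0 → nontrivial (trans (sym 1·1≈1) (1≈0 0F)))
    (λ { 0F → ≡.refl ; 1F → ≡.refl ; 2F → ≡.refl })
    u (λ { 0F → refl ; 1F → refl ; 2F → sym 1·1≈1 }) u-step covers
    where
    2·1≈0 : 2 · 1# ≈ 0#
    2·1≈0 = Characteristic.q·1≈0 F
    leftInverse : reduceᴹ (jordan₃⁻¹ ⊛ jordan₃) ≈ᴹ 1ᴹ
    leftInverse 0F 0F = 1·1≈1
    leftInverse 0F 1F = 2·1≈0
    leftInverse 0F 2F = 2·1≈0
    leftInverse 1F 0F = refl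
    leftInverse 1F 1F = 1·1≈1
    leftInverse 1F 2F = 2·1≈0
    leftInverse 2F 0F = refl
    leftInverse 2F 1F = refl
    leftInverse 2F 2F = 1·1≈1
    rightInverse : reduceᴹ (jordan₃ ⊛ jordan₃⁻¹) ≈ᴹ 1ᴹ
    rightInverse 0F 0F = 1·1≈1
    rightInverse 0F 1F = 2·1≈0
    rightInverse 0F 2F = 2·1≈0
    rightInverse 1F 0F = refl
    rightInverse 1F 1F = 1·1≈1
    rightInverse 1F 2F = 2·1≈0
    rightInverse 2F 0F = refl
    rightInverse 2F 1F = refl
    rightInverse 2F 2F = 1·1≈1
    -- The first coordinate 0, 0, 1, 3, ... and the second 0, 1, 2, 3, ... run modulo 2 through all four pairs.
    u : ℕ → Fin 3 → ℕ
    u k 0F = triangular k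
    u k 1F = k
    u k 2F = 1
    u-step : ∀ k i → (jordan₃ ⊛ⱽ u k) i ≡ u (suc k) i
    u-step k 0F = ≡.trans (≡.cong₂ ℕ._+_ (ℕ.+-identityʳ (triangular k)) (≡.trans (ℕ.+-identityʳ (k ℕ.+ 0)) (ℕ.+-identityʳ k))) (ℕ.+-comm (triangular k) k)
    u-step k 1F = k+0+1≡suc-k k
    u-step k 2F = ≡.refl
    covers : ∀ x → ∃[ k ] affine {2} x ≋ reduceⱽ (u k)
    covers x = cases (Characteristic.prime-field F prime[2] (x 0F)) (Characteristic.prime-field F prime[2] (x 1F))
      where
      3·1≈1 : 3 · 1# ≈ 1 · 1#
      3·1≈1 = +-congˡ 2·1≈0
      cases : ∃[ i ] x 0F ≈ toℕ {2} i · 1# → ∃[ j ] x 1F ≈ toℕ {2} j · 1# → ∃[ k ] affine {2} x ≋ reduceⱽ (u k)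
      cases (0F , x₀) (0F , x₁) = 0 , λ { 0F → x₀ ; 1F → x₁ ; 2F → sym 1·1≈1 }
      cases (0F , x₀) (1F , x₁) = 1 , λ { 0F → x₀ ; 1F → x₁ ; 2F → sym 1·1≈1 }
      cases (1F , x₀) (0F , x₁) = 2 , λ { 0F → x₀ ; 1F → trans x₁ (sym 2·1≈0) ; 2F → sym 1·1≈1 }
      cases (1F , x₀) (1F , x₁) = 3 , λ { 0F → trans x₀ (sym 3·1≈1) ; 1F → trans x₁ (sym 3·1≈1) ; 2F → sym 1·1≈1 }

theorem2p4 : ∀ {c ℓ₁ ℓ₂ : Level} (q n : ℕ) → IsPrimePower q → 1 ≤ n → (F : FiniteField q c ℓ₁ ℓ₂) →
    let open Geometry F in
    (¬ (Prime q × n ≡ 1) → ¬ (q ≡ 2 × n ≡ 2) →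
    ∀ (Ψ : Automorphism n) → Transitive (ℙ n) (action Ψ) ⇔ Transitive (𝔸 n) (fractionalJump Ψ))
    ×
    ((Prime q × n ≡ 1) ⊎ (q ≡ 2 × n ≡ 2) →
    Σ[ Ψ ∈ Automorphism n ] (Transitive (𝔸 n) (fractionalJump Ψ) × ¬ Transitive (ℙ n) (action Ψ)))
theorem2p4 q n q-primePower 1≤n F =
  (λ ¬case₁ ¬case₂ Ψ → mk⇔ (transitive⇒jump-transitive F Ψ)
    (jump-transitive⇒transitive F Ψ q-primePower 1≤n ¬case₁ ¬case₂)) ,
  λ { (inj₁ (q-prime , ≡.refl))  → NaturalMatrices.prime-counterexample F q-prime
    ; (inj₂ (≡.refl , ≡.refl))   → 𝔽₂-counterexample F }
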